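{- Let $p,q\ge0$, $p+q\ge1$, let $S_1,\dots,S_{p+q}$ be the basis matrices of a non-degenerate representation of $R_{p,q}=C_p\otimes C_q$ on $W=\mathbb{R}^m$, and let $\tilde P(w)=S_1[w]^2+\cdots+S_p[w]^2-S_{p+1}[w]^2-\cdots-S_{p+q}[w]^2$ be the associated Clifford quartic form. Then $\tilde P$ is a homaloidal EKP-polynomial, and the multiplicative Legendre transform of $\tilde P$ coincides with $\tilde P$ itself up to a constant factor.
   Context: $C_r$ denotes the real Clifford algebra of the positive definite quadratic form in $r$ variables (generators $e_i$, $e_i^2=1$, $e_ie_j=-e_je_i$ for $i\ne j$; $C_0=\mathbb{R}$). $R_{p,q}=C_p\otimes_{\mathbb{R}}C_q$ (ungraded tensor product), with $e_1,\dots,e_p$ the generators of $C_p$ and $e_{p+1},\dots,e_{p+q}$ those of $C_q$. A (unital) representation $\rho$ on $\mathbb{R}^m$ is taken so that the basis matrices $S_i=\rho(e_i)$ are symmetric; $S[w]={}^tw\,S\,w$. The representation is non-degenerate if $Q(w)=(S_1[w],\dots,S_{p+q}[w])$, as a polynomial map $\mathbb{C}^m\to\mathbb{C}^{p+q}$, has differential of rank $p+q$ at all points with $\tilde P\neq0$ and the set of such points is non-empty. Polynomials on $W$ are regarded as polynomials on $\mathbf{W}=\mathbb{C}^m$, and $\mathbf{W}^*$ is identified with $\mathbb{C}^m$ via the standard bilinear form. A homogeneous rational function $f$ on a finite-dimensional vector space $\mathbf{V}$ is homaloidal if $v\mapsto\mathrm{grad}\,f(v)$ defines a birational map $\mathbb{P}(\mathbf{V})\to\mathbb{P}(\mathbf{V}^*)$.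 For a homaloidal $f$ there is a rational function $f^*$ on $\mathbf{V}^*$ with $f^*(\mathrm{grad}\log f(v))=1/f(v)$, called the multiplicative Legendre transform of $f$. A polynomial $f$ is a homaloidal EKP-polynomial if $f$ is homaloidal and $f^*$ is also a polynomial. -}

module Defs where

open import Level using (0ℓ)
open import Algebra.Bundles using (CommutativeSemiring; Ring; Semiring; CommutativeRing)
open import Algebra.Definitions using (Invertible)
open import Algebra.Structures using (IsRing; IsCommutativeRing)
open import Algebra.Apartness using (HeytingCommutativeRing; HeytingField; IsHeytingField)
open import Algebra.Morphism.Structures using (module RingMorphisms)
open import Data.Bool.Base using (if_then_else_)
open import Data.Empty using (⊥; ⊥-elim)
open import Data.Fin.Base using (Fin; zero; suc; splitAt; _↑ˡ_; _↑ʳ_)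
open import Data.Fin.Properties using (_≟_)
open import Data.Nat.Base as ℕ using (ℕ; zero; suc)
open import Data.Product.Base using (Σ-syntax; ∃-syntax; _×_; _,_; proj₁; proj₂)
open import Data.Sum.Base using (_⊎_; inj₁; inj₂; [_,_]′)
open import Data.Vec.Functional using (Vector)
open import Function.Base using (_∘_; id)
open import Relation.Binary.Core using (Rel)
open import Relation.Binary.PropositionalEquality.Core as ≡ using (_≡_; _≢_)
open import Relation.Binary.Structures using (IsEquivalence; IsStrictPartialOrder; IsApartnessRelation)
open import Relation.Nullary.Decidable.Core using (does; yes; no)
import Algebra.Apartness.Properties.HeytingCommutativeRing as HeytingProperties
import Algebra.Definitions.RawSemiring as RawSemiringDefinitions
import Algebra.Properties.Ring as RingProperties
import Algebra.Properties.Semiring.Sum as SemiringSum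
import Algebra.Solver.Ring.NaturalCoefficients.Default as NaturalSolver
import Relation.Binary.Reasoning.Setoid as SetoidReasoning

-- The real numbers, characterised as the Cauchy-complete Archimedean
-- ordered field.  The axioms are those satisfied by the constructive
-- (Bishop) reals; classically ℝ is their only model up to isomorphism.
-- Apartness x # y is the positive form of x ≠ y, and #⇒<⊎> together with
-- cotransitivity of # makes the order linear.

record RealNumbers : Set₁ where
  infix 4 _<_
  field
    heytingField : HeytingField 0ℓ 0ℓ 0ℓ
  open HeytingField heytingField public
  commutativeRing : CommutativeRing 0ℓ 0ℓ
  commutativeRing = HeytingCommutativeRing.commutativeRing heytingCommutativeRing
  open RawSemiringDefinitions (CommutativeSemiring.rawSemiring (CommutativeRing.commutativeSemiring commutativeRing)) public
    using () renaming (_×_ to _·_)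
  field
    _<_                  : Rel Carrier 0ℓ
    isStrictPartialOrder : IsStrictPartialOrder _≈_ _<_
    <⇒#                  : ∀ {x y} → x < y → x # y
    #⇒<⊎>                : ∀ {x y} → x # y → x < y ⊎ y < x
    +-monoˡ-<            : ∀ z {x y} → x < y → x + z < y + z
    *-pos                : ∀ {x y} → 0# < x → 0# < y → 0# < x * y
    archimedean          : ∀ x → ∃[ n ] x < n · 1#

  -- Differences are compared with 1 / (k + 1), after clearing the denominator.
  Cauchy : (ℕ → Carrier) → Set
  Cauchy x = ∀ k → ∃[ N ] ∀ i j → N ℕ.≤ i → N ℕ.≤ j → suc k · (x i - x j) < 1#

  _⟶_ : (ℕ → Carrier) → Carrier → Set
  x ⟶ l = ∀ k → ∃[ N ] ∀ i → N ℕ.≤ i →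
          (suc k · (x i - l) < 1#) × (suc k · (l - x i) < 1#)

  field
    complete             : ∀ x → Cauchy x → ∃[ l ] x ⟶ l

module Algebras (K : CommutativeRing 0ℓ 0ℓ) where
  private module K = CommutativeRing K
  open RingMorphisms using (IsRingHomomorphism)

  record Algebra : Set₁ where
    field
      ring : Ring 0ℓ 0ℓ
    open Ring ring public
    field
      scalar       : K.Carrier → Carrier
      scalar-homo  : IsRingHomomorphism K.rawRing rawRing scalar
      scalar-comm  : ∀ k x → scalar k * x ≈ x * scalar k

  record AlgebraHom (A B : Algebra) : Set where
    private
      module A = Algebra A
      module B = Algebra B
    field
      ⟦_⟧            : A.Carrier → B.Carrier
      isHomomorphism : IsRingHomomorphism A.rawRing B.rawRing ⟦_⟧
      scalar-homo    : ∀ k → ⟦ A.scalar k ⟧ B.≈ B.scalar k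

  -- The algebra presented by generators X and relations R: terms modulo
  -- the congruence generated by the K-algebra laws and R.
  module Presentation (X : Set) where
    infixl 6 _+ᵗ_
    infixl 7 _*ᵗ_

    data Term : Set where
      gen       : X → Term
      con       : K.Carrier → Term
      _+ᵗ_ _*ᵗ_ : Term → Term → Term
      -ᵗ_       : Term → Term

    module Quotient (R : Rel Term 0ℓ) where
      infix 4 _∼_

      data _∼_ : Rel Term 0ℓ where
        relation  : ∀ {s t} → R s t → s ∼ t
        refl      : ∀ {s} → s ∼ s
        sym       : ∀ {s t} → s ∼ t → t ∼ s
        trans     : ∀ {s t u} → s ∼ t → t ∼ u → s ∼ u
        +-cong    : ∀ {s s′ t t′} → s ∼ s′ → t ∼ t′ → s +ᵗ t ∼ s′ +ᵗ t′
        *-cong    : ∀ {s s′ t t′} → s ∼ s′ → t ∼ t′ → s *ᵗ t ∼ s′ *ᵗ t′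
        -‿cong    : ∀ {s t} → s ∼ t → -ᵗ s ∼ -ᵗ t
        +-assoc   : ∀ s t u → (s +ᵗ t) +ᵗ u ∼ s +ᵗ (t +ᵗ u)
        +-comm    : ∀ s t → s +ᵗ t ∼ t +ᵗ s
        +-idˡ     : ∀ s → con K.0# +ᵗ s ∼ s
        -‿invˡ    : ∀ s → (-ᵗ s) +ᵗ s ∼ con K.0#
        *-assoc   : ∀ s t u → (s *ᵗ t) *ᵗ u ∼ s *ᵗ (t *ᵗ u)
        *-idˡ     : ∀ s → con K.1# *ᵗ s ∼ s
        distribˡ  : ∀ s t u → s *ᵗ (t +ᵗ u) ∼ s *ᵗ t +ᵗ s *ᵗ u
        distribʳ  : ∀ s t u → (t +ᵗ u) *ᵗ s ∼ t *ᵗ s +ᵗ u *ᵗ s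
        con-cong  : ∀ {k l} → k K.≈ l → con k ∼ con l
        con-+     : ∀ k l → con (k K.+ l) ∼ con k +ᵗ con l
        con-*     : ∀ k l → con (k K.* l) ∼ con k *ᵗ con l
        con-neg   : ∀ k → con (K.- k) ∼ -ᵗ con k
        con-comm  : ∀ k s → con k *ᵗ s ∼ s *ᵗ con k

      isEquivalence : IsEquivalence _∼_
      isEquivalence = record { refl = refl ; sym = sym ; trans = trans }

      isRing : IsRing _∼_ _+ᵗ_ _*ᵗ_ -ᵗ_ (con K.0#) (con K.1#)
      isRing = record
        { +-isAbelianGroup = record
          { isGroup = record
            { isMonoid = record
              { isSemigroup = record
                { isMagma = record { isEquivalence = isEquivalence ; ∙-cong = +-cong }
                ; assoc = +-assoc }
              ; identity = +-idˡ , λ s → trans (+-comm s _) (+-idˡ s) }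
            ; inverse = -‿invˡ , λ s → trans (+-comm s _) (-‿invˡ s)
            ; ⁻¹-cong = -‿cong }
          ; comm = +-comm }
        ; *-cong = *-cong
        ; *-assoc = *-assoc
        ; *-identity = *-idˡ , λ s → trans (sym (con-comm K.1# s)) (*-idˡ s)
        ; distrib = distribˡ , distribʳ
        }

      algebra : Algebra
      algebra = record
        { ring = record { isRing = isRing }
        ; scalar = con
        ; scalar-homo = record
          { isSemiringHomomorphism = record
            { isNearSemiringHomomorphism = record
              { +-isMonoidHomomorphism = record
                { isMagmaHomomorphism = record
                  { isRelHomomorphism = record { cong = con-cong }
                  ; homo = con-+ }
                ; ε-homo = refl }
              ; *-homo = con-* }
            ; 1#-homo = refl }
          ; -‿homo = con-neg }
        ; scalar-comm = con-comm
        }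

  module CliffordAlgebra (r : ℕ) where
    open Presentation (Fin r) public

    data Relation : Rel Term 0ℓ where
      square : ∀ i → Relation (gen i *ᵗ gen i) (con K.1#)
      anti   : ∀ i j → i ≢ j → Relation (gen i *ᵗ gen j) (-ᵗ (gen j *ᵗ gen i))

    open Quotient Relation public

  C : ℕ → Algebra
  C = CliffordAlgebra.algebra

  e : ∀ {r} → Fin r → Algebra.Carrier (C r)
  e {r} = CliffordAlgebra.gen {r}

  -- A ⊗ B as the algebra generated by the pure tensors a ⊗ b, subject to
  -- bilinearity and (a ⊗ b)(a′ ⊗ b′) = aa′ ⊗ bb′.
  module TensorProduct (A B : Algebra) where
    private
      module A = Algebra A
      module B = Algebra B
    open Presentation (A.Carrier × B.Carrier) public

    data Relation : Rel Term 0ℓ where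
      cong     : ∀ {a a′ b b′} → a A.≈ a′ → b B.≈ b′ →
                 Relation (gen (a , b)) (gen (a′ , b′))
      linearˡ  : ∀ a a′ b → Relation (gen (a A.+ a′ , b)) (gen (a , b) +ᵗ gen (a′ , b))
      linearʳ  : ∀ a b b′ → Relation (gen (a , b B.+ b′)) (gen (a , b) +ᵗ gen (a , b′))
      scalarˡ  : ∀ k a b → Relation (gen (A.scalar k A.* a , b)) (con k *ᵗ gen (a , b))
      scalarʳ  : ∀ k a b → Relation (gen (a , B.scalar k B.* b)) (con k *ᵗ gen (a , b))
      multiply : ∀ a a′ b b′ →
                 Relation (gen (a , b) *ᵗ gen (a′ , b′)) (gen (a A.* a′ , b B.* b′))
      unit     : Relation (gen (A.1# , B.1#)) (con K.1#)

    open Quotient Relation public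

  infixl 7 _⊗_

  _⊗_ : Algebra → Algebra → Algebra
  A ⊗ B = TensorProduct.algebra A B

  R[_,_] : ℕ → ℕ → Algebra
  R[ p , q ] = C p ⊗ C q

  basis : ∀ p q → Fin (p ℕ.+ q) → Algebra.Carrier R[ p , q ]
  basis p q i =
    [ (λ a → gen (e a , Algebra.1# (C q))) , (λ b → gen (Algebra.1# (C p) , e b)) ]′ (splitAt p i)
    where open TensorProduct (C p) (C q) using (gen)

module Matrices (K : CommutativeRing 0ℓ 0ℓ) where
  open CommutativeRing K hiding (zero)
  open SemiringSum semiring
  open RingProperties ring using (-0#≈0#; -‿+-comm; -‿distribˡ-*)
  open Algebras K using (Algebra)
  open SetoidReasoning setoid

  Matrix : ℕ → Set
  Matrix m = Fin m → Fin m → Carrier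

  module _ {m : ℕ} where
    infix 4 _≈ᴹ_
    infixl 6 _+ᴹ_
    infixl 7 _*ᴹ_

    _≈ᴹ_ : Rel (Matrix m) 0ℓ
    M ≈ᴹ N = ∀ i j → M i j ≈ N i j

    _+ᴹ_ _*ᴹ_ : Matrix m → Matrix m → Matrix m
    (M +ᴹ N) i j = M i j + N i j
    (M *ᴹ N) i j = ∑[ k < m ] (M i k * N k j)

    -ᴹ_ : Matrix m → Matrix m
    (-ᴹ M) i j = - M i j

    scalarᴹ : Carrier → Matrix m
    scalarᴹ k i j = if does (i ≟ j) then k else 0#

    SymmetricMatrix : Matrix m → Set
    SymmetricMatrix M = ∀ i j → M i j ≈ M j i

  private
    zero-sum : ∀ {n} (f : Vector Carrier n) → (∀ i → f i ≈ 0#) → sum f ≈ 0#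
    zero-sum {n} f f≈0 = trans (sum-cong-≋ {n} f≈0) (sum-replicate-zero n)

    suc-≟ : ∀ {n} {A : Set} (i j : Fin n) {x y : A} →
            (if does (suc i ≟ suc j) then x else y) ≡ (if does (i ≟ j) then x else y)
    suc-≟ i j with i ≟ j
    ... | yes _ = ≡.refl
    ... | no  _ = ≡.refl

    scalar-sumˡ : ∀ {n} k i (f : Vector Carrier n) →
                  ∑[ j < n ] (scalarᴹ k i j * f j) ≈ k * f i
    scalar-sumˡ {suc n} k zero    f =
      trans (+-congˡ (zero-sum {n} _ (λ j → zeroˡ (f (suc j))))) (+-identityʳ _)
    scalar-sumˡ {suc n} k (suc i) f = begin
      0# * f zero + ∑[ j < n ] (scalarᴹ k (suc i) (suc j) * f (suc j))
        ≈⟨ +-cong (zeroˡ _) (sum-cong-≋ {n} (λ j → *-congʳ (reflexive (suc-≟ i j)))) ⟩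
      0# + ∑[ j < n ] (scalarᴹ k i j * f (suc j))
        ≈⟨ +-identityˡ _ ⟩
      ∑[ j < n ] (scalarᴹ k i j * f (suc j))
        ≈⟨ scalar-sumˡ k i (f ∘ suc) ⟩
      k * f (suc i) ∎

    scalar-sumʳ : ∀ {n} k j (f : Vector Carrier n) →
                  ∑[ i < n ] (f i * scalarᴹ k i j) ≈ f j * k
    scalar-sumʳ {suc n} k zero    f =
      trans (+-congˡ (zero-sum {n} _ (λ i → zeroʳ (f (suc i))))) (+-identityʳ _)
    scalar-sumʳ {suc n} k (suc j) f = begin
      f zero * 0# + ∑[ i < n ] (f (suc i) * scalarᴹ k (suc i) (suc j))
        ≈⟨ +-cong (zeroʳ _) (sum-cong-≋ {n} (λ i → *-congˡ (reflexive (suc-≟ i j)))) ⟩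
      0# + ∑[ i < n ] (f (suc i) * scalarᴹ k i j)
        ≈⟨ +-identityˡ _ ⟩
      ∑[ i < n ] (f (suc i) * scalarᴹ k i j)
        ≈⟨ scalar-sumʳ k j (f ∘ suc) ⟩
      f (suc j) * k ∎

    *ᴹ-assoc : ∀ {m} (A B D : Matrix m) → ((A *ᴹ B) *ᴹ D) ≈ᴹ (A *ᴹ (B *ᴹ D))
    *ᴹ-assoc {m} A B D i j = begin
      ∑[ l < m ] (∑[ k < m ] (A i k * B k l) * D l j)
        ≈⟨ sum-cong-≋ {m} (λ l → *-distribʳ-sum {m} (D l j) (λ k → A i k * B k l)) ⟩
      ∑[ l < m ] ∑[ k < m ] (A i k * B k l * D l j)
        ≈⟨ ∑-comm {m} {m} (λ l k → A i k * B k l * D l j) ⟩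
      ∑[ k < m ] ∑[ l < m ] (A i k * B k l * D l j)
        ≈⟨ sum-cong-≋ {m} (λ k → sum-cong-≋ {m} (λ l → *-assoc (A i k) (B k l) (D l j))) ⟩
      ∑[ k < m ] ∑[ l < m ] (A i k * (B k l * D l j))
        ≈⟨ sum-cong-≋ {m} (λ k → *-distribˡ-sum {m} (A i k) (λ l → B k l * D l j)) ⟨
      ∑[ k < m ] (A i k * ∑[ l < m ] (B k l * D l j)) ∎

  matrixRing : ℕ → Ring 0ℓ 0ℓ
  matrixRing m = record
    { Carrier = Matrix m
    ; _≈_ = _≈ᴹ_
    ; _+_ = _+ᴹ_
    ; _*_ = _*ᴹ_
    ; -_ = -ᴹ_
    ; 0# = λ _ _ → 0#
    ; 1# = scalarᴹ 1#
    ; isRing = record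
      { +-isAbelianGroup = record
        { isGroup = record
          { isMonoid = record
            { isSemigroup = record
              { isMagma = record
                { isEquivalence = record
                  { refl = λ i j → refl
                  ; sym = λ p i j → sym (p i j)
                  ; trans = λ p q i j → trans (p i j) (q i j) }
                ; ∙-cong = λ p q i j → +-cong (p i j) (q i j) }
              ; assoc = λ A B D i j → +-assoc (A i j) (B i j) (D i j) }
            ; identity = (λ A i j → +-identityˡ (A i j)) , (λ A i j → +-identityʳ (A i j)) }
          ; inverse = (λ A i j → -‿inverseˡ (A i j)) , (λ A i j → -‿inverseʳ (A i j))
          ; ⁻¹-cong = λ p i j → -‿cong (p i j) }
        ; comm = λ A B i j → +-comm (A i j) (B i j) }
      ; *-cong = λ p q i j → sum-cong-≋ {m} (λ k → *-cong (p i k) (q k j))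
      ; *-assoc = *ᴹ-assoc
      ; *-identity =
          (λ A i j → trans (scalar-sumˡ 1# i (λ k → A k j)) (*-identityˡ _)) ,
          (λ A i j → trans (scalar-sumʳ 1# j (A i)) (*-identityʳ _))
      ; distrib =
          (λ A B D i j → trans
            (sum-cong-≋ {m} (λ k → distribˡ (A i k) (B k j) (D k j)))
            (∑-distrib-+ {m} (λ k → A i k * B k j) (λ k → A i k * D k j))) ,
          (λ A B D i j → trans
            (sum-cong-≋ {m} (λ k → distribʳ (A k j) (B i k) (D i k)))
            (∑-distrib-+ {m} (λ k → B i k * A k j) (λ k → D i k * A k j)))
      }
    }

  matrixAlgebra : ℕ → Algebra
  matrixAlgebra m = record
    { ring = matrixRing m
    ; scalar = scalarᴹ
    ; scalar-homo = record
      { isSemiringHomomorphism = record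
        { isNearSemiringHomomorphism = record
          { +-isMonoidHomomorphism = record
            { isMagmaHomomorphism = record
              { isRelHomomorphism = record { cong = scalar-cong }
              ; homo = scalar-+ }
            ; ε-homo = scalar-0 }
          ; *-homo = scalar-* }
        ; 1#-homo = λ i j → refl }
      ; -‿homo = scalar-neg }
    ; scalar-comm = λ k A i j → trans (scalar-sumˡ k i (λ l → A l j))
        (trans (*-comm k (A i j)) (sym (scalar-sumʳ k j (A i))))
    }
    where
    scalar-cong : ∀ {k l} → k ≈ l → scalarᴹ {m} k ≈ᴹ scalarᴹ l
    scalar-cong k≈l i j with i ≟ j
    ... | yes _ = k≈l
    ... | no  _ = refl

    scalar-+ : ∀ k l → scalarᴹ {m} (k + l) ≈ᴹ scalarᴹ k +ᴹ scalarᴹ l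
    scalar-+ k l i j with i ≟ j
    ... | yes _ = refl
    ... | no  _ = sym (+-identityˡ 0#)

    scalar-0 : scalarᴹ {m} 0# ≈ᴹ (λ _ _ → 0#)
    scalar-0 i j with i ≟ j
    ... | yes _ = refl
    ... | no  _ = refl

    scalar-neg : ∀ k → scalarᴹ {m} (- k) ≈ᴹ (-ᴹ scalarᴹ k)
    scalar-neg k i j with i ≟ j
    ... | yes _ = refl
    ... | no  _ = sym -0#≈0#

    scalar-mul : ∀ k l → scalarᴹ {m} (k * l) ≈ᴹ (λ i j → k * scalarᴹ l i j)
    scalar-mul k l i j with i ≟ j
    ... | yes _ = refl
    ... | no  _ = sym (zeroʳ k)

    scalar-* : ∀ k l → scalarᴹ {m} (k * l) ≈ᴹ scalarᴹ k *ᴹ scalarᴹ l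
    scalar-* k l i j = trans (scalar-mul k l i j) (sym (scalar-sumˡ k i (λ h → scalarᴹ l h j)))

infixl 6 _⊞_
infixl 7 _⊠_
infix  8 ⊟_

data Polynomial (A : Set) (n : ℕ) : Set where
  con     : A → Polynomial A n
  var     : Fin n → Polynomial A n
  _⊞_ _⊠_ : Polynomial A n → Polynomial A n → Polynomial A n
  ⊟_      : Polynomial A n → Polynomial A n

mapCoefficients : ∀ {A B n} → (A → B) → Polynomial A n → Polynomial B n
mapCoefficients f (con a) = con (f a)
mapCoefficients f (var i) = var i
mapCoefficients f (p ⊞ q) = mapCoefficients f p ⊞ mapCoefficients f q
mapCoefficients f (p ⊠ q) = mapCoefficients f p ⊠ mapCoefficients f q
mapCoefficients f (⊟ p)   = ⊟ mapCoefficients f p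

module Polynomials (K : CommutativeRing 0ℓ 0ℓ) where
  open CommutativeRing K hiding (zero)
  open Matrices K using (Matrix)

  Poly : ℕ → Set
  Poly = Polynomial Carrier

  eval : ∀ {n} → Poly n → Vector Carrier n → Carrier
  eval (con a) v = a
  eval (var i) v = v i
  eval (p ⊞ q) v = eval p v + eval q v
  eval (p ⊠ q) v = eval p v * eval q v
  eval (⊟ p)   v = - eval p v

  ∂ : ∀ {n} → Fin n → Poly n → Poly n
  ∂ i (con a) = con 0#
  ∂ i (var j) = con (if does (i ≟ j) then 1# else 0#)
  ∂ i (p ⊞ q) = ∂ i p ⊞ ∂ i q
  ∂ i (p ⊠ q) = (∂ i p ⊠ q) ⊞ (p ⊠ ∂ i q)
  ∂ i (⊟ p)   = ⊟ ∂ i p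

  sumᵖ : ∀ {k n} → (Fin k → Poly n) → Poly n
  sumᵖ {zero}  p = con 0#
  sumᵖ {suc k} p = p zero ⊞ sumᵖ (p ∘ suc)

  -- S[w] = ᵗw S w as a polynomial in w
  _[w] : ∀ {m} → Matrix m → Poly m
  S [w] = sumᵖ (λ a → sumᵖ (λ b → var a ⊠ con (S a b) ⊠ var b))

-- Identities between polynomials, including homogeneity, are tested
-- pointwise.  This is faithful over an infinite field; the module is
-- instantiated only at ℂ.

module RationalFunctions (K : HeytingField 0ℓ 0ℓ 0ℓ) where
  open HeytingField K
  commutativeRing : CommutativeRing 0ℓ 0ℓ
  commutativeRing = HeytingCommutativeRing.commutativeRing heytingCommutativeRing
  open CommutativeRing commutativeRing using (semiring)
  open RawSemiringDefinitions (Semiring.rawSemiring semiring) using (_^_)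
  open SemiringSum semiring using (sum)
  open HeytingProperties heytingCommutativeRing using (1#0; x#0y#0→xy#0)
  open Polynomials commutativeRing public

  Nonzero : ∀ {n} → Poly n → Set
  Nonzero p = ∃[ v ] eval p v # 0#

  Homogeneous : ∀ {n} → ℕ → Poly n → Set
  Homogeneous d p = ∀ t v → eval p (λ i → t * v i) ≈ t ^ d * eval p v

  record RationalFunction (n : ℕ) : Set where
    field
      num den     : Poly n
      den-nonzero : Nonzero den
  open RationalFunction public

  infix 4 _≐_ _at_↦_ _∥_

  _≐_ : ∀ {n} → Rel (RationalFunction n) 0ℓ
  f ≐ g = ∀ v → eval (num f) v * eval (den g) v ≈ eval (num g) v * eval (den f) v

  -- f is defined at v, with value c
  _at_↦_ : ∀ {n} → RationalFunction n → Vector Carrier n → Carrier → Set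
  f at v ↦ c = (eval (den f) v # 0#) × (c * eval (den f) v ≈ eval (num f) v)

  polynomial : ∀ {n} → Poly n → RationalFunction n
  polynomial p = record { num = p ; den = con 1# ; den-nonzero = (λ _ → 0#) , 1#0 }

  -- homogeneous of degree a - b
  HomogeneousRational : ∀ {n} → RationalFunction n → Set
  HomogeneousRational f = ∃[ a ] ∃[ b ] ∀ t v →
    t ^ b * (eval (num f) (λ i → t * v i) * eval (den f) v)
      ≈ t ^ a * (eval (num f) v * eval (den f) (λ i → t * v i))

  grad : ∀ {n} → RationalFunction n → Fin n → RationalFunction n
  grad f i = record
    { num = (∂ i (num f) ⊠ den f) ⊞ ⊟ (num f ⊠ ∂ i (den f))
    ; den = den f ⊠ den f
    ; den-nonzero = let v , d#0 = den-nonzero f in v , x#0y#0→xy#0 d#0 d#0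
    }

  -- u = grad log f (v) = f(v)⁻¹ grad f (v), at a point v where f is
  -- defined and non-zero
  GradLog : ∀ {n} → RationalFunction n → (v u : Vector Carrier n) → Set
  GradLog {n} f v u = ∃[ c ] Σ[ g ∈ Vector Carrier n ]
    (f at v ↦ c) × (c # 0#) × (∀ i → grad f i at v ↦ g i) × (∀ i → c * u i ≈ g i)

  -- A rational map P(Kⁿ) ⇢ P(Kⁿ), in homogeneous coordinates
  record RationalMap (n : ℕ) : Set where
    field
      component   : Fin n → Poly n
      degree      : ℕ
      homogeneous : ∀ i → Homogeneous degree (component i)
      nonzero     : ∃[ i ] Nonzero (component i)

    apply : Vector Carrier n → Vector Carrier n
    apply v i = eval (component i) v
  open RationalMap public using (apply)

  _∥_ : ∀ {n} → Rel (Vector Carrier n) 0ℓ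
  u ∥ v = ∀ i j → u i * v j ≈ v i * u j

  -- ψ ∘ φ is defined as a rational map and is the identity
  _LeftInverseOf_ : ∀ {n} → RationalMap n → RationalMap n → Set
  ψ LeftInverseOf φ =
    (∃[ v ] ∃[ i ] apply ψ (apply φ v) i # 0#) × (∀ v → apply ψ (apply φ v) ∥ v)

  Birational : ∀ {n} → RationalMap n → Set
  Birational φ = ∃[ ψ ] (ψ LeftInverseOf φ) × (φ LeftInverseOf ψ)

  -- the tuple g of rational functions, taken as homogeneous coordinates,
  -- defines the rational map φ
  Defines : ∀ {n} → (Fin n → RationalFunction n) → RationalMap n → Set
  Defines g φ =
    (∃[ i ] Nonzero (num (g i))) × (∀ v x → (∀ i → g i at v ↦ x i) → x ∥ apply φ v)

  -- The dual of Kⁿ is identified with Kⁿ via the standard bilinear form.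
  Homaloidal : ∀ {n} → RationalFunction n → Set
  Homaloidal f = HomogeneousRational f × ∃[ φ ] Defines (grad f) φ × Birational φ

  -- f*(grad log f (v)) = 1 / f(v) as rational functions of v: the composite
  -- on the left is defined at some point, and equality holds wherever both
  -- sides are.  For homaloidal f of non-zero degree, v ↦ grad log f (v) is
  -- dominant, so this does not depend on the fractions representing f and f*.
  IsMultiplicativeLegendreTransform : ∀ {n} → (f f* : RationalFunction n) → Set
  IsMultiplicativeLegendreTransform f f* =
    (∃[ v ] ∃[ u ] ∃[ b ] GradLog f v u × (f* at u ↦ b)) ×
    (∀ v u b c → GradLog f v u → f* at u ↦ b → f at v ↦ c → b * c ≈ 1#)

  IsHomaloidalEKP : ∀ {n} → Poly n → Set
  IsHomaloidalEKP f = Homaloidal (polynomial f) ×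
    ∃[ f* ] IsMultiplicativeLegendreTransform (polynomial f) f* × ∃[ g ] f* ≐ polynomial g

  -- The linear map with matrix A has rank r: its image has a basis of r vectors.
  HasRank : ∀ {k l} → (Fin k → Fin l → Carrier) → ℕ → Set
  HasRank {k} {l} A r = Σ[ b ∈ (Fin r → Vector Carrier k) ]
    (∀ j → ∃[ x ] ∀ i → image x i ≈ b j i) ×
    (∀ c → (∀ i → combination b c i ≈ 0#) → ∀ j → c j ≈ 0#) ×
    (∀ x → ∃[ c ] ∀ i → image x i ≈ combination b c i)
    where
    image : Vector Carrier l → Vector Carrier k
    image x i = sum (λ a → A i a * x a)

    combination : (Fin r → Vector Carrier k) → Vector Carrier r → Vector Carrier k
    combination b c i = sum (λ j → c j * b j i)

module Complex (𝓡 : RealNumbers) where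
  open RealNumbers 𝓡
  private
    module O = IsStrictPartialOrder isStrictPartialOrder
    open CommutativeRing commutativeRing using (commutativeSemiring; ring)
    open RingProperties ring
    open HeytingProperties heytingCommutativeRing
    open NaturalSolver commutativeSemiring using (solve; _:=_; _:+_; _:*_)
    open SetoidReasoning setoid

  infix 6 _+i_

  record ℂ : Set where
    constructor _+i_
    field
      re im : Carrier
  open ℂ public

  infix  4 _≈ᶜ_ _#ᶜ_
  infixl 6 _+ᶜ_
  infixl 7 _*ᶜ_

  _≈ᶜ_ _#ᶜ_ : Rel ℂ 0ℓ
  z ≈ᶜ w = (re z ≈ re w) × (im z ≈ im w)
  z #ᶜ w = (re z # re w) ⊎ (im z # im w)

  _+ᶜ_ _*ᶜ_ : ℂ → ℂ → ℂ
  z +ᶜ w = (re z + re w) +i (im z + im w)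
  z *ᶜ w = (re z * re w - im z * im w) +i (re z * im w + im z * re w)

  -ᶜ_ : ℂ → ℂ
  -ᶜ z = (- re z) +i (- im z)

  fromReal : Carrier → ℂ
  fromReal x = x +i 0#

  0ᶜ 1ᶜ : ℂ
  0ᶜ = fromReal 0#
  1ᶜ = fromReal 1#

  private
    ring-sub : ∀ x y → x - y ≈ x + (- 1#) * y
    ring-sub x y = +-congˡ (sym (-1*x≈-x y))

    *ᶜ-comm : ∀ z w → z *ᶜ w ≈ᶜ w *ᶜ z
    *ᶜ-comm (a +i b) (c +i d) =
      +-cong (*-comm a c) (-‿cong (*-comm b d)) ,
      trans (+-comm _ _) (+-cong (*-comm b c) (*-comm a d))

    *ᶜ-assoc : ∀ z w u → (z *ᶜ w) *ᶜ u ≈ᶜ z *ᶜ (w *ᶜ u)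
    *ᶜ-assoc (a +i b) (c +i d) (r +i s) =
      (begin
        (a * c - b * d) * r - (a * d + b * c) * s
          ≈⟨ trans (ring-sub _ _) (+-congʳ (*-congʳ (ring-sub _ _))) ⟩
        (a * c + N * (b * d)) * r + N * ((a * d + b * c) * s)
          ≈⟨ solve 7 (λ a b c d r s N →
               (a :* c :+ N :* (b :* d)) :* r :+ N :* ((a :* d :+ b :* c) :* s) :=
               a :* (c :* r :+ N :* (d :* s)) :+ N :* (b :* (c :* s :+ d :* r)))
               refl a b c d r s N ⟩
        a * (c * r + N * (d * s)) + N * (b * (c * s + d * r))
          ≈⟨ trans (ring-sub _ _) (+-congʳ (*-congˡ (ring-sub _ _))) ⟨
        a * (c * r - d * s) - b * (c * s + d * r) ∎) ,
      (begin
        (a * c - b * d) * s + (a * d + b * c) * r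
          ≈⟨ +-congʳ (*-congʳ (ring-sub _ _)) ⟩
        (a * c + N * (b * d)) * s + (a * d + b * c) * r
          ≈⟨ solve 7 (λ a b c d r s N →
               (a :* c :+ N :* (b :* d)) :* s :+ (a :* d :+ b :* c) :* r :=
               a :* (c :* s :+ d :* r) :+ b :* (c :* r :+ N :* (d :* s)))
               refl a b c d r s N ⟩
        a * (c * s + d * r) + b * (c * r + N * (d * s))
          ≈⟨ +-congˡ (*-congˡ (ring-sub _ _)) ⟨
        a * (c * s + d * r) + b * (c * r - d * s) ∎)
      where N = - 1#

    *ᶜ-idˡ : ∀ z → 1ᶜ *ᶜ z ≈ᶜ z
    *ᶜ-idˡ (a +i b) =
      (begin
        1# * a - 0# * b ≈⟨ +-cong (*-identityˡ a) (trans (-‿cong (zeroˡ b)) -0#≈0#) ⟩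
        a + 0#          ≈⟨ +-identityʳ a ⟩
        a               ∎) ,
      trans (+-cong (*-identityˡ b) (zeroˡ a)) (+-identityʳ b)

    ᶜ-distribʳ : ∀ u z w → (z +ᶜ w) *ᶜ u ≈ᶜ z *ᶜ u +ᶜ w *ᶜ u
    ᶜ-distribʳ (r +i s) (a +i b) (c +i d) =
      (begin
        (a + c) * r - (b + d) * s
          ≈⟨ ring-sub _ _ ⟩
        (a + c) * r + N * ((b + d) * s)
          ≈⟨ solve 7 (λ a b c d r s N →
               (a :+ c) :* r :+ N :* ((b :+ d) :* s) :=
               (a :* r :+ N :* (b :* s)) :+ (c :* r :+ N :* (d :* s)))
               refl a b c d r s N ⟩
        (a * r + N * (b * s)) + (c * r + N * (d * s))
          ≈⟨ +-cong (ring-sub _ _) (ring-sub _ _) ⟨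
        (a * r - b * s) + (c * r - d * s) ∎) ,
      solve 6 (λ a b c d r s →
        (a :+ c) :* s :+ (b :+ d) :* r := (a :* s :+ b :* r) :+ (c :* s :+ d :* r))
        refl a b c d r s
      where N = - 1#

    ≈ᶜ-trans : ∀ {z w u} → z ≈ᶜ w → w ≈ᶜ u → z ≈ᶜ u
    ≈ᶜ-trans (p , q) (r , s) = trans p r , trans q s

    *ᶜ-cong : ∀ {z z′ w w′} → z ≈ᶜ z′ → w ≈ᶜ w′ → z *ᶜ w ≈ᶜ z′ *ᶜ w′
    *ᶜ-cong (p , q) (r , s) =
      +-cong (*-cong p r) (-‿cong (*-cong q s)) , +-cong (*-cong p s) (*-cong q r)

    +ᶜ-cong : ∀ {z z′ w w′} → z ≈ᶜ z′ → w ≈ᶜ w′ → z +ᶜ w ≈ᶜ z′ +ᶜ w′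
    +ᶜ-cong (p , q) (r , s) = +-cong p r , +-cong q s

    isCommutativeRingᶜ : IsCommutativeRing _≈ᶜ_ _+ᶜ_ _*ᶜ_ -ᶜ_ 0ᶜ 1ᶜ
    isCommutativeRingᶜ = record
      { isRing = record
        { +-isAbelianGroup = record
          { isGroup = record
            { isMonoid = record
              { isSemigroup = record
                { isMagma = record
                  { isEquivalence = record
                    { refl = refl , refl
                    ; sym = λ { (p , q) → sym p , sym q }
                    ; trans = ≈ᶜ-trans }
                  ; ∙-cong = +ᶜ-cong }
                ; assoc = λ z w u → +-assoc _ _ _ , +-assoc _ _ _ }
              ; identity = (λ z → +-identityˡ _ , +-identityˡ _) ,
                           (λ z → +-identityʳ _ , +-identityʳ _) }
            ; inverse = (λ z → -‿inverseˡ _ , -‿inverseˡ _) ,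
                        (λ z → -‿inverseʳ _ , -‿inverseʳ _)
            ; ⁻¹-cong = λ { (p , q) → -‿cong p , -‿cong q } }
          ; comm = λ z w → +-comm _ _ , +-comm _ _ }
        ; *-cong = *ᶜ-cong
        ; *-assoc = *ᶜ-assoc
        ; *-identity = *ᶜ-idˡ , λ z → ≈ᶜ-trans (*ᶜ-comm z 1ᶜ) (*ᶜ-idˡ z)
        ; distrib =
            (λ z w u → ≈ᶜ-trans (*ᶜ-comm z (w +ᶜ u)) (≈ᶜ-trans (ᶜ-distribʳ z w u)
              (+ᶜ-cong (*ᶜ-comm w z) (*ᶜ-comm u z)))) ,
            ᶜ-distribʳ
        }
      ; *-comm = *ᶜ-comm
      }

    right-inverse⇒#0 : ∀ {x y} → x * y ≈ 1# → x # 0#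
    right-inverse⇒#0 {x} {y} xy≈1 =
      invertibleʳ⇒# (y , trans (*-congʳ (x-0≈x x)) xy≈1)

    #0⇒inverse : ∀ {x} → x # 0# → ∃[ y ] x * y ≈ 1#
    #0⇒inverse {x} x#0 with y , _ , p ← #⇒invertible x#0 =
      y , trans (*-congʳ (sym (x-0≈x x))) p

    factorˡ#0 : ∀ {x y} → x * y # 0# → x # 0#
    factorˡ#0 {x} {y} xy#0 with z , p ← #0⇒inverse xy#0 =
      right-inverse⇒#0 (trans (sym (*-assoc x y z)) p)

    factorʳ#0 : ∀ {x y} → x * y # 0# → y # 0#
    factorʳ#0 xy#0 = factorˡ#0 (#-congʳ (*-comm _ _) xy#0)

    #⇒-#0 : ∀ {x y} → x # y → x - y # 0#
    #⇒-#0 x#y with z , _ , p ← #⇒invertible x#y = right-inverse⇒#0 p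

    -#0⇒# : ∀ {x y} → x - y # 0# → x # y
    -#0⇒# d#0 = invertibleʳ⇒# (#0⇒inverse d#0)

    square-pos : ∀ {x} → x # 0# → 0# < x * x
    square-pos {x} x#0 with #⇒<⊎> x#0
    ... | inj₂ 0<x = *-pos 0<x 0<x
    ... | inj₁ x<0 = O.<-respʳ-≈ [-x]²≈x² (*-pos 0<-x 0<-x)
      where
      0<-x : 0# < - x
      0<-x = O.<-respˡ-≈ (-‿inverseʳ x) (O.<-respʳ-≈ (+-identityˡ _) (+-monoˡ-< (- x) x<0))

      [-x]²≈x² : - x * - x ≈ x * x
      [-x]²≈x² = begin
        - x * - x     ≈⟨ -‿distribˡ-* x (- x) ⟨
        - (x * - x)   ≈⟨ -‿cong (-‿distribʳ-* x x) ⟨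
        - (- (x * x)) ≈⟨ -‿involutive (x * x) ⟩
        x * x         ∎

    square≮0 : ∀ {x} → x * x < 0# → ⊥
    square≮0 x²<0 = O.asym x²<0 (square-pos (factorˡ#0 (<⇒# x²<0)))

    sum≮square : ∀ x y → x * x + y * y < x * x → ⊥
    sum≮square x y s<x² = square≮0 (O.<-respˡ-≈ (xyx⁻¹≈y (x * x) (y * y))
      (O.<-respʳ-≈ (-‿inverseʳ (x * x)) (+-monoˡ-< (- (x * x)) s<x²)))

    sum-of-squares-pos : ∀ {x} y → x # 0# → 0# < x * x + y * y
    sum-of-squares-pos {x} y x#0 with #-cotrans (<⇒# (square-pos x#0)) (x * x + y * y)
    ... | inj₁ 0#s = [ id , (λ s<0 → ⊥-elim (sum≮square x y (O.trans s<0 (square-pos x#0)))) ]′ (#⇒<⊎> 0#s)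
    ... | inj₂ s#x² = [ (λ s<x² → ⊥-elim (sum≮square x y s<x²)) , O.trans (square-pos x#0) ]′ (#⇒<⊎> s#x²)

    norm#0 : ∀ x y → x # 0# ⊎ y # 0# → x * x + y * y # 0#
    norm#0 x y (inj₁ x#0) = #-sym (<⇒# (sum-of-squares-pos y x#0))
    norm#0 x y (inj₂ y#0) =
      #-congʳ (+-comm _ _) (#-sym (<⇒# (sum-of-squares-pos x y#0)))

    inverseᶜ : ∀ z → re z # 0# ⊎ im z # 0# → ∃[ w ] z *ᶜ w ≈ᶜ 1ᶜ
    inverseᶜ (a +i b) z#0 with n , p ← #0⇒inverse (norm#0 a b z#0) =
      ((a * n) +i (- (b * n))) ,
      (begin
        a * (a * n) - b * - (b * n)
          ≈⟨ +-congˡ (-‿cong (-‿distribʳ-* b (b * n))) ⟨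
        a * (a * n) - - (b * (b * n))
          ≈⟨ +-congˡ (-‿involutive _) ⟩
        a * (a * n) + b * (b * n)
          ≈⟨ solve 3 (λ a b n → a :* (a :* n) :+ b :* (b :* n) := (a :* a :+ b :* b) :* n)
               refl a b n ⟩
        (a * a + b * b) * n
          ≈⟨ p ⟩
        1# ∎) ,
      (begin
        a * - (b * n) + b * (a * n)
          ≈⟨ +-cong (sym (-‿distribʳ-* a (b * n)))
               (solve 3 (λ a b n → b :* (a :* n) := a :* (b :* n)) refl a b n) ⟩
        - (a * (b * n)) + a * (b * n)
          ≈⟨ -‿inverseˡ _ ⟩
        0# ∎)

    invertible⇒#ᶜ : ∀ {z w} → Invertible _≈ᶜ_ 1ᶜ _*ᶜ_ (z +ᶜ (-ᶜ w)) → z #ᶜ w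
    invertible⇒#ᶜ {z} {w} (v , _ , p , _) =
      [ (λ d#ac → inj₂ (-#0⇒# (factorˡ#0 (bd#0 d#ac)))) ,
        (λ ac#0 → inj₁ (-#0⇒# (factorˡ#0 ac#0))) ]′
        (#-cotrans (#-congʳ (sym p) 1#0) ac)
      where
      ac = (re z - re w) * re v
      bd = (im z - im w) * im v

      bd#0 : ac - bd # ac → bd # 0#
      bd#0 d#ac with y , q ← #0⇒inverse (#⇒-#0 d#ac) = right-inverse⇒#0 {y = - y} (begin
        bd * - y             ≈⟨ -‿distribʳ-* bd y ⟨
        - (bd * y)           ≈⟨ -‿distribˡ-* bd y ⟩
        - bd * y             ≈⟨ *-congʳ (xyx⁻¹≈y ac (- bd)) ⟨
        ((ac - bd) - ac) * y ≈⟨ q ⟩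
        1#                   ∎)

    isApartnessRelationᶜ : IsApartnessRelation _≈ᶜ_ _#ᶜ_
    isApartnessRelationᶜ = record
      { irrefl = λ { (p , _) (inj₁ a) → #-irrefl p a ; (_ , q) (inj₂ b) → #-irrefl q b }
      ; sym = λ { (inj₁ a) → inj₁ (#-sym a) ; (inj₂ b) → inj₂ (#-sym b) }
      ; cotrans = λ
        { (inj₁ a) u → [ inj₁ ∘ inj₁ , inj₂ ∘ inj₁ ]′ (#-cotrans a (re u))
        ; (inj₂ b) u → [ inj₁ ∘ inj₂ , inj₂ ∘ inj₂ ]′ (#-cotrans b (im u)) }
      }

  isHeytingFieldᶜ : IsHeytingField _≈ᶜ_ _#ᶜ_ _+ᶜ_ _*ᶜ_ -ᶜ_ 0ᶜ 1ᶜ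
  isHeytingFieldᶜ = record
    { isHeytingCommutativeRing = record
      { isCommutativeRing = isCommutativeRingᶜ
      ; isApartnessRelation = isApartnessRelationᶜ
      ; #⇒invertible = λ {z} {w} z#w →
          let v , p = inverseᶜ (z +ᶜ (-ᶜ w)) ([ inj₁ ∘ #⇒-#0 , inj₂ ∘ #⇒-#0 ]′ z#w)
          in v , ≈ᶜ-trans (*ᶜ-comm v _) p , p
      ; invertible⇒# = invertible⇒#ᶜ
      }
    ; tight = λ z w →
        (λ ¬# → proj₁ (tight _ _) (¬# ∘ inj₁) , proj₁ (tight _ _) (¬# ∘ inj₂)) ,
        (λ { (p , _) (inj₁ a) → proj₂ (tight _ _) p a
           ; (_ , q) (inj₂ b) → proj₂ (tight _ _) q b })
    }

  ℂ-field : HeytingField 0ℓ 0ℓ 0ℓ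
  ℂ-field = record { isHeytingField = isHeytingFieldᶜ }

module CliffordQuarticForms (𝓡 : RealNumbers) where
  ℝ-ring : CommutativeRing 0ℓ 0ℓ
  ℝ-ring = RealNumbers.commutativeRing 𝓡

  open Complex 𝓡 public using (ℂ; ℂ-field; fromReal)
  open Algebras ℝ-ring public using (AlgebraHom; R[_,_]; basis)
  open Matrices ℝ-ring public using (Matrix; SymmetricMatrix; matrixAlgebra)
  open RationalFunctions ℂ-field public
  open HeytingField ℂ-field public using (_#_; 0#)
  module ℝ-Poly = Polynomials ℝ-ring

  Representation : ℕ → ℕ → ℕ → Set
  Representation p q m = AlgebraHom R[ p , q ] (matrixAlgebra m)

  basisMatrix : ∀ {p q m} → Representation p q m → Fin (p ℕ.+ q) → Matrix m
  basisMatrix {p} {q} ρ i = AlgebraHom.⟦_⟧ ρ (basis p q i)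

  -- Real polynomials on W are regarded as complex polynomials on 𝐖.
  complexify : ∀ {m} → ℝ-Poly.Poly m → Poly m
  complexify = mapCoefficients fromReal

  module _ (p q : ℕ) {m : ℕ} (S : Fin (p ℕ.+ q) → Matrix m) where

    P̃-real : ℝ-Poly.Poly m
    P̃-real = ℝ-Poly.sumᵖ {p} (λ i → S (i ↑ˡ q) ℝ-Poly.[w] ⊠ S (i ↑ˡ q) ℝ-Poly.[w])
           ⊞ ⊟ ℝ-Poly.sumᵖ {q} (λ j → S (p ↑ʳ j) ℝ-Poly.[w] ⊠ S (p ↑ʳ j) ℝ-Poly.[w])

    P̃ : Poly m
    P̃ = complexify P̃-real

    Q : Fin (p ℕ.+ q) → Poly m
    Q i = complexify (S i ℝ-Poly.[w])

    NonDegenerate : Set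
    NonDegenerate =
      (∀ w → eval P̃ w # 0# → HasRank (λ i a → eval (∂ a (Q i)) w) (p ℕ.+ q)) ×
      (∃[ w ] eval P̃ w # 0#)

{-# OPTIONS --safe #-}
module Submission where

-- Put x_i = S_i[v] (i ≤ p), y_j = S_{p+j}[v], B = Σ x_i S_i, D = Σ y_j S_{p+j}, N = B - D and
-- N⁺ = B + D.  By the Clifford relations B² = Σ x_i² and D² = Σ y_j², and B commutes with D, so
-- N N⁺ = N⁺ N = P̃(v).  The gradient of P̃ at v is 4 N v.  From N S_i N = 2 x_i N - P̃(v) S_i and
-- N S_{p+j} N = P̃(v) S_{p+j} - 2 y_j N one gets S_i[N v] = P̃(v) x_i and S_{p+j}[N v] = - P̃(v) y_j:
-- passing from v to N v replaces N by P̃(v) N⁺.  Hence grad P̃ (grad P̃ (v)) = 4⁴ P̃(v)² v, so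
-- the gradient map is a projective involution; with Euler's identity, P̃(v) P̃(grad log P̃ (v)) = 4⁴.

open import Defs
open import Level using (0ℓ)
open import Algebra.Apartness using (HeytingField)
open import Algebra.Bundles using (CommutativeRing; Ring; Semiring)
open import Algebra.Morphism.Structures using (module RingMorphisms)
open import Data.Bool.Base using (true; false)
open import Data.Empty using (⊥-elim)
open import Data.Fin.Base using (Fin; zero; suc; _↑ˡ_; _↑ʳ_)
import Data.Fin.Properties as Fin
open import Data.Nat.Base as ℕ using (ℕ; zero; suc)
import Data.Nat.Properties as ℕ
open import Data.Product.Base using (∃-syntax; Σ-syntax; _×_; _,_; proj₁; proj₂)
open import Data.Sum.Base using (_⊎_; inj₁; inj₂; [_,_]′)
open import Data.Vec.Base using (Vec; []; _∷_)
open import Data.Vec.Functional using (Vector)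
open import Function.Base using (_∘_; const)
open import Relation.Binary.PropositionalEquality.Core as ≡ using (_≡_; _≢_)
open import Relation.Binary.Structures using (IsStrictPartialOrder)
open import Relation.Nullary.Decidable.Core using (does)
import Algebra.Apartness.Properties.HeytingCommutativeRing as HeytingProperties
import Algebra.Definitions.RawSemiring as RawSemiringDefinitions
import Algebra.Properties.Monoid.Mult as Mult
import Algebra.Properties.Ring as RingProperties
import Algebra.Properties.Semiring.Sum as SemiringSum
import Algebra.Solver.CommutativeMonoid as MonoidSolver
import Algebra.Solver.Ring.NaturalCoefficients.Default as NaturalSolver
import Relation.Binary.Reasoning.Setoid as SetoidReasoning

open RingMorphisms using (IsRingHomomorphism)

-- Equality with zero is undecidable here, and the Legendre relation constrains `f*` only where `P`
-- and the denominator of `f*` are apart from zero. Passing from such points to an identity of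
-- polynomials needs a density argument. Tightness reduces an equality to the refutation of an
-- apartness, and joining the given point by a line to a point where a chosen polynomial is apart
-- from zero makes this a statement in one variable; characteristic zero supplies enough test points
-- on the line. The duality argument uses only three facts about the quartic: Euler's identity, the
-- cubic homogeneity of its gradient, and the formula for the doubled gradient. It is therefore
-- carried out for an arbitrary polynomial with these properties. The Clifford relations serve only
-- to establish the three facts. Since the relations are plain equations between generators, they
-- pass from `R[ p , q ]` through `ρ` to real matrices and then entrywise to complex ones.

-- Arithmetic with apartness in a Heyting field.

module HeytingFields (K : HeytingField 0ℓ 0ℓ 0ℓ) where
  open HeytingField K hiding (zero)
  open RationalFunctions K using (commutativeRing)
  open CommutativeRing commutativeRing using (semiring; ring)
  open HeytingProperties heytingCommutativeRing
  open RingProperties ring using (xyx⁻¹≈y)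
  open SemiringSum semiring using (sum)
  open RawSemiringDefinitions (Semiring.rawSemiring semiring) using () renaming (_×_ to _·_)
  open SetoidReasoning setoid

  CharacteristicZero : Set
  CharacteristicZero = ∀ n → suc n · 1# # 0#

  #0⇒inverse : ∀ {x} → x # 0# → ∃[ y ] x * y ≈ 1#
  #0⇒inverse {x} x#0 with y , _ , p ← #⇒invertible x#0 = y , trans (*-congʳ (sym (x-0≈x x))) p

  inverse⇒#0 : ∀ {x y} → x * y ≈ 1# → x # 0#
  inverse⇒#0 {x} {y} p = invertibleʳ⇒# (y , trans (*-congʳ (x-0≈x x)) p)

  factorˡ#0 : ∀ {x y} → x * y # 0# → x # 0#
  factorˡ#0 {x} {y} xy#0 with z , p ← #0⇒inverse xy#0 = inverse⇒#0 (trans (sym (*-assoc x y z)) p)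

  factorʳ#0 : ∀ {x y} → x * y # 0# → y # 0#
  factorʳ#0 xy#0 = factorˡ#0 (#-congʳ (*-comm _ _) xy#0)

  *-cancelˡ-#0 : ∀ {x y z} → x # 0# → x * y ≈ x * z → y ≈ z
  *-cancelˡ-#0 {x} {y} {z} x#0 xy≈xz with w , p ← #0⇒inverse x#0 =
    trans (expand y) (trans (*-congˡ xy≈xz) (sym (expand z)))
    where
    expand : ∀ u → u ≈ w * (x * u)
    expand u = begin
      u           ≈⟨ *-identityˡ u ⟨
      1# * u      ≈⟨ *-congʳ (trans (*-comm w x) p) ⟨
      w * x * u   ≈⟨ *-assoc w x u ⟩
      w * (x * u) ∎

  *-zero-#0 : ∀ {x y} → x # 0# → x * y ≈ 0# → y ≈ 0#
  *-zero-#0 {x} x#0 xy≈0 = *-cancelˡ-#0 x#0 (trans xy≈0 (sym (zeroʳ x)))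

  -- Cotransitivity at `x` separates `x` either from zero or from `x + y`; in the latter case the
  -- difference is `y`.
  +#0 : ∀ {x y} → x + y # 0# → x # 0# ⊎ y # 0#
  +#0 {x} {y} x+y#0 with #-cotrans x+y#0 x
  ... | inj₂ x#0 = inj₁ x#0
  ... | inj₁ x+y#x with z , _ , p ← #⇒invertible x+y#x =
    inj₂ (inverse⇒#0 (trans (*-congʳ (sym (xyx⁻¹≈y x y))) p))

  sum#0 : ∀ {n} (f : Vector Carrier n) → sum f # 0# → ∃[ i ] f i # 0#
  sum#0 {zero}  f 0#0 = ⊥-elim (#-irrefl refl 0#0)
  sum#0 {suc n} f s#0 with +#0 s#0
  ... | inj₁ f₀#0 = zero , f₀#0
  ... | inj₂ t#0 with i , fᵢ#0 ← sum#0 (f ∘ suc) t#0 = suc i , fᵢ#0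

  -- This replaces a case split on whether a factor vanishes: by tightness the product may be
  -- assumed apart from zero, and then so is `y`.
  *-zero-tight : ∀ {x y} → (x * y # 0# → y ≈ 0#) → x * y ≈ 0#
  *-zero-tight f = proj₁ (tight _ _) (λ xy#0 → #-irrefl (f xy#0) (factorʳ#0 xy#0))

-- The identity principle for polynomials in characteristic zero.

module IdentityPrinciple
  (K : HeytingField 0ℓ 0ℓ 0ℓ) (char0 : HeytingFields.CharacteristicZero K) where

  open HeytingField K hiding (zero)
  open RationalFunctions K using (commutativeRing; Poly; eval; Nonzero)
  open HeytingFields K
  open HeytingProperties heytingCommutativeRing
  open CommutativeRing commutativeRing using (ring; commutativeSemiring; +-monoid)
  open RingProperties ring using (xyx⁻¹≈y; -1*x≈-x)
  open Mult +-monoid using (×-homo-+) renaming (_×_ to _·_)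
  open NaturalSolver commutativeSemiring using (solve; con; _:=_; _:+_; _:*_)
  open SetoidReasoning setoid

  horner : ∀ {n} → Vec Carrier n → Carrier → Carrier
  horner []       t = 0#
  horner (c ∷ cs) t = c + t * horner cs t

  horner-cong : ∀ {n} (cs : Vec Carrier n) {s t} → s ≈ t → horner cs s ≈ horner cs t
  horner-cong []       s≈t = refl
  horner-cong (c ∷ cs) s≈t = +-congˡ (*-cong s≈t (horner-cong cs s≈t))

  -- The length of the list only bounds the degree. A leading coefficient apart from zero cannot be
  -- asked for, since one cannot decide which coefficients vanish.
  Univariate : (Carrier → Carrier) → Set
  Univariate f = ∃[ n ] Σ[ cs ∈ Vec Carrier n ] ∀ t → f t ≈ horner cs t

  univariate-≈ : ∀ {f g} → (∀ t → f t ≈ g t) → Univariate g → Univariate f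
  univariate-≈ f≈g (n , cs , p) = n , cs , λ t → trans (f≈g t) (p t)

  univariate-con : ∀ c → Univariate (const c)
  univariate-con c = 1 , c ∷ [] , λ t → sym (trans (+-congˡ (zeroʳ t)) (+-identityʳ c))

  univariate-* : ∀ {f} → Univariate f → Univariate (λ t → t * f t)
  univariate-* (n , cs , p) = suc n , 0# ∷ cs , λ t → trans (*-congˡ (p t)) (sym (+-identityˡ _))

  horner-+ : ∀ {m n} (cs : Vec Carrier m) (ds : Vec Carrier n) → Univariate (λ t → horner cs t + horner ds t)
  horner-+ []       ds = _ , ds , λ t → +-identityˡ _
  horner-+ (c ∷ cs) [] = _ , c ∷ cs , λ t → +-identityʳ _
  horner-+ (c ∷ cs) (d ∷ ds) with n , es , p ← horner-+ cs ds = suc n , c + d ∷ es , λ t → begin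
    (c + t * horner cs t) + (d + t * horner ds t)
      ≈⟨ solve 5 (λ c d t x y → (c :+ t :* x) :+ (d :+ t :* y) := (c :+ d) :+ t :* (x :+ y)) refl c d t _ _ ⟩
    (c + d) + t * (horner cs t + horner ds t)
      ≈⟨ +-congˡ (*-congˡ (p t)) ⟩
    (c + d) + t * horner es t ∎

  univariate-⊞ : ∀ {f g} → Univariate f → Univariate g → Univariate (λ t → f t + g t)
  univariate-⊞ (_ , cs , p) (_ , ds , q) = univariate-≈ (λ t → +-cong (p t) (q t)) (horner-+ cs ds)

  horner-scale : ∀ {n} c (ds : Vec Carrier n) → Univariate (λ t → c * horner ds t)
  horner-scale c [] = 0 , [] , λ t → zeroʳ c
  horner-scale c (d ∷ ds) = univariate-≈
    (λ t → solve 4 (λ c d t x → c :* (d :+ t :* x) := c :* d :+ t :* (c :* x)) refl c d t _)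
    (univariate-⊞ (univariate-con (c * d)) (univariate-* (horner-scale c ds)))

  univariate-⊠ : ∀ {f g} → Univariate f → Univariate g → Univariate (λ t → f t * g t)
  univariate-⊠ (_ , cs , p) (_ , ds , q) = univariate-≈ (λ t → *-cong (p t) (q t)) (go cs)
    where
    go : ∀ {n} (cs : Vec Carrier n) → Univariate (λ t → horner cs t * horner ds t)
    go []       = 0 , [] , λ t → zeroˡ _
    go (c ∷ cs) = univariate-≈
      (λ t → solve 4 (λ c t x y → (c :+ t :* x) :* y := c :* y :+ t :* (x :* y)) refl c t _ _)
      (univariate-⊞ (horner-scale c ds) (univariate-* (go cs)))

  -- Synthetic division by `t - a`: the coefficients of the quotient are the Horner values at `a` of
  -- the successive tails.
  quotient : ∀ {n} → Carrier → Vec Carrier (suc n) → Vec Carrier n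
  quotient a (c ∷ [])         = []
  quotient a (c ∷ cs@(_ ∷ _)) = horner cs a ∷ quotient a cs

  -- Writing the argument as `a + u` removes the subtraction `t - a`, so the identity holds already
  -- in commutative semirings.
  remainder-theorem : ∀ {n} a u (cs : Vec Carrier (suc n)) →
    horner cs (a + u) ≈ horner cs a + u * horner (quotient a cs) (a + u)
  remainder-theorem a u (c ∷ []) =
    solve 3 (λ c a u → c :+ (a :+ u) :* con 0 := (c :+ a :* con 0) :+ u :* con 0) refl c a u
  remainder-theorem a u (c ∷ cs@(_ ∷ _)) = begin
    c + (a + u) * horner cs (a + u)
      ≈⟨ +-congˡ (*-congˡ (remainder-theorem a u cs)) ⟩
    c + (a + u) * (r + u * q)
      ≈⟨ solve 5 (λ c a u r q → c :+ (a :+ u) :* (r :+ u :* q) :=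
           (c :+ a :* r) :+ u :* (r :+ (a :+ u) :* q)) refl c a u r q ⟩
    (c + a * r) + u * (r + (a + u) * q) ∎
    where
    r = horner cs a
    q = horner (quotient a cs) (a + u)

  -- Splitting off the root `N · 1#` shortens the list. The quotient vanishes at all later naturals
  -- because they differ from the root by some `suc j · 1#`, which is apart from zero; `N` is
  -- general so that the induction can move past used roots.
  vanishing-on-ℕ : ∀ {n} (cs : Vec Carrier n) N → (∀ j → horner cs ((N ℕ.+ j) · 1#) ≈ 0#) →
                   ∀ t → horner cs t ≈ 0#
  vanishing-on-ℕ []              N cs≈0 t = refl
  vanishing-on-ℕ cs@(_ ∷ cs′) N cs≈0 t = begin
    horner cs t         ≈⟨ horner-cong cs (shift a t) ⟨
    horner cs (a + (t - a)) ≈⟨ factor (t - a) ⟩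
    (t - a) * horner (quotient a cs) (a + (t - a))
      ≈⟨ *-congˡ (vanishing-on-ℕ (quotient a cs) (suc N) quotient≈0 _) ⟩
    (t - a) * 0# ≈⟨ zeroʳ _ ⟩
    0# ∎
    where
    a = N · 1#

    shift : ∀ a t → a + (t - a) ≈ t
    shift a t = trans (sym (+-assoc a t (- a))) (xyx⁻¹≈y a t)

    factor : ∀ u → horner cs (a + u) ≈ u * horner (quotient a cs) (a + u)
    factor u = begin
      horner cs (a + u) ≈⟨ remainder-theorem a u cs ⟩
      horner cs a + u * horner (quotient a cs) (a + u)
        ≈⟨ +-congʳ (trans (reflexive (≡.cong (λ k → horner cs (k · 1#)) (≡.sym (ℕ.+-identityʳ N)))) (cs≈0 0)) ⟩
      0# + u * horner (quotient a cs) (a + u) ≈⟨ +-identityˡ _ ⟩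
      u * horner (quotient a cs) (a + u) ∎

    quotient≈0 : ∀ j → horner (quotient a cs) ((suc N ℕ.+ j) · 1#) ≈ 0#
    quotient≈0 j = *-zero-#0 (char0 j) (begin
      suc j · 1# * horner (quotient a cs) ((suc N ℕ.+ j) · 1#)
        ≈⟨ *-congˡ (horner-cong (quotient a cs) a+j) ⟨
      suc j · 1# * horner (quotient a cs) (a + suc j · 1#)
        ≈⟨ factor (suc j · 1#) ⟨
      horner cs (a + suc j · 1#)
        ≈⟨ horner-cong cs (×-homo-+ 1# N (suc j)) ⟨
      horner cs ((N ℕ.+ suc j) · 1#)
        ≈⟨ cs≈0 (suc j) ⟩
      0# ∎)
      where
      a+j : a + suc j · 1# ≈ (suc N ℕ.+ j) · 1#
      a+j = trans (sym (×-homo-+ 1# N (suc j))) (reflexive (≡.cong (_· 1#) (ℕ.+-suc N j)))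

  -- This is what allows a factor `t` to be cancelled. The test points start at one, so
  -- characteristic zero keeps all of them apart from zero.
  vanishing-off-0 : ∀ {f} → Univariate f → (∀ t → t # 0# → f t ≈ 0#) → ∀ t → f t ≈ 0#
  vanishing-off-0 (_ , cs , p) f≈0 t =
    trans (p t) (vanishing-on-ℕ cs 1 (λ j → trans (sym (p _)) (f≈0 _ (char0 j))) t)

  -- Coefficients of the second factor vanish one after the other, lowest degree first.
  zero-product : ∀ {n} (cs : Vec Carrier n) {f} → Univariate f → f 0# # 0# →
                 (∀ t → f t * horner cs t ≈ 0#) → ∀ t → horner cs t ≈ 0#
  zero-product []       uf f₀#0 fg≈0 t = refl
  zero-product (c ∷ cs) {f} uf f₀#0 fg≈0 t =
    trans (drop t) (trans (*-congˡ (zero-product cs uf f₀#0 tail≈0 t)) (zeroʳ t))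
    where
    c≈0 : c ≈ 0#
    c≈0 = *-zero-#0 f₀#0 (trans (*-congˡ (sym (trans (+-congˡ (zeroˡ _)) (+-identityʳ c)))) (fg≈0 0#))

    drop : ∀ t → c + t * horner cs t ≈ t * horner cs t
    drop t = trans (+-congʳ c≈0) (+-identityˡ _)

    tail≈0 : ∀ t → f t * horner cs t ≈ 0#
    tail≈0 = vanishing-off-0 (univariate-⊠ uf (_ , cs , λ t → refl)) (λ t t#0 → *-zero-#0 t#0 (begin
      t * (f t * horner cs t) ≈⟨ solve 3 (λ t x y → t :* (x :* y) := x :* (t :* y)) refl t _ _ ⟩
      f t * (t * horner cs t) ≈⟨ *-congˡ (drop t) ⟨
      f t * (c + t * horner cs t) ≈⟨ fg≈0 t ⟩
      0# ∎))

  eval-cong : ∀ {n} (p : Poly n) {v w} → (∀ i → v i ≈ w i) → eval p v ≈ eval p w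
  eval-cong (Defs.con a) v≈w = refl
  eval-cong (var i) v≈w = v≈w i
  eval-cong (p ⊞ q) v≈w = +-cong (eval-cong p v≈w) (eval-cong q v≈w)
  eval-cong (p ⊠ q) v≈w = *-cong (eval-cong p v≈w) (eval-cong q v≈w)
  eval-cong (⊟ p)   v≈w = -‿cong (eval-cong p v≈w)

  restriction-to-line : ∀ {n} (p : Poly n) (v d : Vector Carrier n) → Univariate (λ t → eval p (λ i → v i + t * d i))
  restriction-to-line (Defs.con a) v d = univariate-con a
  restriction-to-line (var i) v d = univariate-⊞ (univariate-con (v i)) (univariate-* (univariate-con (d i)))
  restriction-to-line (p ⊞ q) v d = univariate-⊞ (restriction-to-line p v d) (restriction-to-line q v d)
  restriction-to-line (p ⊠ q) v d = univariate-⊠ (restriction-to-line p v d) (restriction-to-line q v d)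
  restriction-to-line (⊟ p)   v d = univariate-≈ (λ t → sym (-1*x≈-x _))
    (univariate-⊠ (univariate-con (- 1#)) (restriction-to-line p v d))

  -- Suppose `h` is apart from zero at `v`, and join `v` to a point `w` where `g` is. On this line
  -- the product of `g` and `h` vanishes, by `*-zero-tight`. Since `h` is apart from zero at
  -- `t = 0`, `zero-product` makes `g` vanish along the whole line, which fails at `t = 1`.
  identity-principle : ∀ {n} (g h : Poly n) → Nonzero g → (∀ v → eval g v # 0# → eval h v ≈ 0#) →
                       ∀ v → eval h v ≈ 0#
  identity-principle g h (w , gw#0) h≈0 v = proj₁ (tight _ _) (λ hv#0 →
    let _ , cs , p = restriction-to-line g v d
        hg≈0 t = trans (*-comm _ _) (*-zero-tight (λ gh#0 → h≈0 _ (factorˡ#0 gh#0)))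
        cs≈0 = zero-product cs (restriction-to-line h v d)
                 (#-congʳ (eval-cong h (λ i → sym (trans (+-congˡ (zeroˡ _)) (+-identityʳ _)))) hv#0)
                 (λ t → trans (*-congˡ (sym (p t))) (hg≈0 t))
    in #-irrefl refl (#-congʳ (trans (eval-cong g (λ i → sym (endpoint i))) (trans (p 1#) (cs≈0 1#))) gw#0))
    where
    d = λ i → w i - v i

    endpoint : ∀ i → v i + 1# * d i ≈ w i
    endpoint i = trans (+-congˡ (*-identityˡ _)) (trans (sym (+-assoc _ _ _)) (xyx⁻¹≈y (v i) (w i)))

-- Polynomials whose gradient map is a projective involution.

module SelfDuality
  (K : HeytingField 0ℓ 0ℓ 0ℓ) (char0 : HeytingFields.CharacteristicZero K) where

  open HeytingField K hiding (zero)
  open RationalFunctions K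
  open HeytingFields K
  open IdentityPrinciple K char0 using (eval-cong; identity-principle)
  open HeytingProperties heytingCommutativeRing
  open CommutativeRing commutativeRing using (ring; semiring; commutativeSemiring)
  open RawSemiringDefinitions (Semiring.rawSemiring semiring) using (_^_)
  open RingProperties ring using (x∙y⁻¹≈ε⇒x≈y; -0#≈0#)
  open SemiringSum semiring using (sum; sum-cong-≋; *-distribˡ-sum)
  open NaturalSolver commutativeSemiring using (solve; con; _:=_; _:*_)
  open SetoidReasoning setoid

  ∇ : ∀ {n} → Poly n → Vector Carrier n → Vector Carrier n
  ∇ P v i = eval (∂ i P) v

  -- The Legendre transform is a relation between fractions, so its coincidence with `P` is
  -- expressed by one constant that serves every `f*` in the relation.
  SelfDual : ∀ {n} → Poly n → Set
  SelfDual P = IsHomaloidalEKP P ×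
    (∃[ c ] (c # 0#) × (∀ f* → IsMultiplicativeLegendreTransform (polynomial P) f* →
      f* ≐ polynomial (Polynomial.con c ⊠ P)))

  module _ {n : ℕ} (P : Poly n) (κ l : Carrier) (κ#0 : κ # 0#) (l#0 : l # 0#)
    (P≢0   : Nonzero P)
    (euler : ∀ v → sum (λ i → v i * ∇ P v i) ≈ κ * eval P v)
    (∇-cubic : ∀ i → Homogeneous 3 (∂ i P))
    (∇∇    : ∀ v i → ∇ P (∇ P v) i ≈ l * (eval P v * eval P v) * v i) where

    -- Euler's identity recovers `κ * P` from the gradient; the coordinate in each term raises the
    -- degree from three to four.
    P-quartic : Homogeneous 4 P
    P-quartic t v = *-cancelˡ-#0 κ#0 (begin
      κ * eval P (λ i → t * v i)
        ≈⟨ euler _ ⟨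
      sum (λ i → t * v i * ∇ P (λ i → t * v i) i)
        ≈⟨ sum-cong-≋ {n} (λ i → trans (*-congˡ (∇-cubic i t v)) (rearrange₁ t (v i) (t ^ 3) _)) ⟩
      sum (λ i → t * t ^ 3 * (v i * ∇ P v i))
        ≈⟨ *-distribˡ-sum {n} (t * t ^ 3) _ ⟨
      t * t ^ 3 * sum (λ i → v i * ∇ P v i)
        ≈⟨ *-congˡ (euler v) ⟩
      t * t ^ 3 * (κ * eval P v)
        ≈⟨ rearrange₂ (t * t ^ 3) κ (eval P v) ⟩
      κ * (t ^ 4 * eval P v) ∎)
      where
      rearrange₁ : ∀ a b c d → a * b * (c * d) ≈ a * c * (b * d)
      rearrange₁ = solve 4 (λ a b c d → a :* b :* (c :* d) := a :* c :* (b :* d)) refl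

      rearrange₂ : ∀ a b c → a * (b * c) ≈ b * (a * c)
      rearrange₂ = solve 3 (λ a b c → a :* (b :* c) := b :* (a :* c)) refl

    -- In Euler's identity at the point `∇ P v`, the doubled gradient is a multiple of `v`, so the
    -- sum becomes the Euler sum at `v` again.
    P-∇ : ∀ v → eval P (∇ P v) ≈ l * (eval P v * eval P v * eval P v)
    P-∇ v = *-cancelˡ-#0 κ#0 (begin
      κ * eval P (∇ P v)
        ≈⟨ euler _ ⟨
      sum (λ i → ∇ P v i * ∇ P (∇ P v) i)
        ≈⟨ sum-cong-≋ {n} (λ i → trans (*-congˡ (∇∇ v i)) (rearrange₁ (∇ P v i) _ (v i))) ⟩
      sum (λ i → l * (eval P v * eval P v) * (v i * ∇ P v i))
        ≈⟨ *-distribˡ-sum {n} (l * (eval P v * eval P v)) _ ⟨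
      l * (eval P v * eval P v) * sum (λ i → v i * ∇ P v i)
        ≈⟨ *-congˡ (euler v) ⟩
      l * (eval P v * eval P v) * (κ * eval P v)
        ≈⟨ rearrange₂ l (eval P v) κ ⟩
      κ * (l * (eval P v * eval P v * eval P v)) ∎)
      where
      rearrange₁ : ∀ a b c → a * (b * c) ≈ b * (c * a)
      rearrange₁ = solve 3 (λ a b c → a :* (b :* c) := b :* (c :* a)) refl

      rearrange₂ : ∀ l p k → l * (p * p) * (k * p) ≈ k * (l * (p * p * p))
      rearrange₂ = solve 3 (λ l p k → l :* (p :* p) :* (k :* p) := k :* (l :* (p :* p :* p))) refl

    -- One index serves two purposes: its gradient factor shows that `φ` is not zero, and its
    -- coordinate factor shows that the composite of `φ` with itself is not zero.
    nonzero-term : ∀ v → eval P v # 0# → ∃[ i ] v i * ∇ P v i # 0#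
    nonzero-term v Pv#0 = sum#0 _ (#-congʳ (sym (euler v)) (x#0y#0→xy#0 κ#0 Pv#0))

    φ : RationalMap n
    φ = record
      { component   = λ i → ∂ i P
      ; degree      = 3
      ; homogeneous = ∇-cubic
      ; nonzero     = let v , Pv#0 = P≢0 ; i , t#0 = nonzero-term v Pv#0 in i , v , factorʳ#0 t#0
      }

    φ-involutive : φ LeftInverseOf φ
    φ-involutive = nonzero , λ v i j → begin
      ∇ P (∇ P v) i * v j ≈⟨ *-congʳ (∇∇ v i) ⟩
      l * (eval P v * eval P v) * v i * v j
        ≈⟨ solve 3 (λ a b c → a :* b :* c := b :* (a :* c)) refl _ (v i) (v j) ⟩
      v i * (l * (eval P v * eval P v) * v j) ≈⟨ *-congˡ (∇∇ v j) ⟨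
      v i * ∇ P (∇ P v) j ∎
      where
      nonzero : ∃[ v ] ∃[ i ] ∇ P (∇ P v) i # 0#
      nonzero = let v , Pv#0 = P≢0 ; i , t#0 = nonzero-term v Pv#0 in
        v , i , #-congʳ (sym (∇∇ v i))
          (x#0y#0→xy#0 (x#0y#0→xy#0 l#0 (x#0y#0→xy#0 Pv#0 Pv#0)) (factorˡ#0 t#0))

    grad-num : ∀ v i → eval (num (grad (polynomial P) i)) v ≈ ∇ P v i
    grad-num v i = begin
      ∇ P v i * 1# + - (eval P v * 0#) ≈⟨ +-cong (*-identityʳ _) (trans (-‿cong (zeroʳ _)) -0#≈0#) ⟩
      ∇ P v i + 0#                     ≈⟨ +-identityʳ _ ⟩
      ∇ P v i ∎

    grad-at : ∀ {v i x} → grad (polynomial P) i at v ↦ x → x ≈ ∇ P v i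
    grad-at {v} {i} (_ , p) =
      trans (sym (trans (*-congˡ (*-identityʳ 1#)) (*-identityʳ _))) (trans p (grad-num v i))

    defines : Defines (grad (polynomial P)) φ
    defines = (let i , v , p = RationalMap.nonzero φ in i , v , #-congʳ (sym (grad-num v i)) p) ,
      λ v x x≈∇ i j → *-cong (grad-at (x≈∇ i)) (sym (grad-at (x≈∇ j)))

    homaloidal : Homaloidal (polynomial P)
    homaloidal = (4 , 0 , λ t v → begin
        1# * (eval P (λ i → t * v i) * 1#) ≈⟨ *-identityˡ _ ⟩
        eval P (λ i → t * v i) * 1#        ≈⟨ *-congʳ (P-quartic t v) ⟩
        t ^ 4 * eval P v * 1#              ≈⟨ *-assoc (t ^ 4) (eval P v) 1# ⟩
        t ^ 4 * (eval P v * 1#)            ∎) ,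
      φ , defines , φ , φ-involutive , φ-involutive

    -- For denominator one, the existential values in `GradLog` are determined by `P` and its
    -- gradient; this is the relation with them eliminated.
    IsGradLog : (v u : Vector Carrier n) → Set
    IsGradLog v u = (eval P v # 0#) × (∀ i → eval P v * u i ≈ ∇ P v i)

    gradLog⁻ : ∀ {v u} → GradLog (polynomial P) v u → IsGradLog v u
    gradLog⁻ (c , g , (_ , c≈P) , c#0 , g≈∇ , cu≈g) =
      #-congʳ c≈P′ c#0 , λ i → trans (*-congʳ (sym c≈P′)) (trans (cu≈g i) (grad-at (g≈∇ i)))
      where c≈P′ = trans (sym (*-identityʳ c)) c≈P

    gradLog⁺ : ∀ {v u} → IsGradLog v u → GradLog (polynomial P) v u
    gradLog⁺ {v} (Pv#0 , Pu≈∇) = eval P v , ∇ P v , (1#0 , *-identityʳ _) , Pv#0 ,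
      (λ i → x#0y#0→xy#0 1#0 1#0 ,
        trans (*-congˡ (*-identityʳ 1#)) (trans (*-identityʳ _) (sym (grad-num v i)))) ,
      Pu≈∇

    isGradLog-at : ∀ {v} → eval P v # 0# → ∃[ u ] IsGradLog v u
    isGradLog-at {v} Pv#0 with y , p ← #0⇒inverse Pv#0 =
      (λ i → y * ∇ P v i) , Pv#0 ,
      λ i → trans (sym (*-assoc _ _ _)) (trans (*-congʳ p) (*-identityˡ _))

    -- With `x` for `P(v)`, homogeneity clears the denominator of `u`: `x ^ 4 * P(u)` is `P(∇ P v)`,
    -- which is `l` times the cube of `x`.
    value-at-gradLog : ∀ {v u} → IsGradLog v u → eval P v * eval P u ≈ l
    value-at-gradLog {v} {u} (Pv#0 , Pu≈∇) = *-cancelˡ-#0 (x#0y#0→xy#0 (x#0y#0→xy#0 Pv#0 Pv#0) Pv#0) (begin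
      x * x * x * (x * eval P u)       ≈⟨ solve 2 (λ x y → x :* x :* x :* (x :* y) :=
                                            (x :* (x :* (x :* (x :* con 1)))) :* y) refl x (eval P u) ⟩
      x ^ 4 * eval P u                 ≈⟨ P-quartic x u ⟨
      eval P (λ i → x * u i)           ≈⟨ eval-cong P Pu≈∇ ⟩
      eval P (∇ P v)                   ≈⟨ P-∇ v ⟩
      l * (x * x * x)                  ≈⟨ *-comm _ _ ⟩
      x * x * x * l ∎)
      where x = eval P v

    -- The logarithmic gradient is an honest involution, with no projective factor left: with `x`
    -- for `P(v)`, both `x ^ 3 * ∇ P u` and `x ^ 3 * P(u) * v` equal the doubled gradient at `v`,
    -- the latter because `l` is `x * P(u)`.
    gradLog-sym : ∀ {v u} → IsGradLog v u → IsGradLog u v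
    gradLog-sym {v} {u} vu@(Pv#0 , Pu≈∇) = factorʳ#0 (#-congʳ (sym PvPu≈l) l#0) , λ i →
      *-cancelˡ-#0 Pv#0 (*-cancelˡ-#0 (x#0y#0→xy#0 Pv#0 Pv#0) (begin
        x * x * (x * (eval P u * v i))
          ≈⟨ *-congˡ (trans (sym (*-assoc _ _ _)) (*-congʳ PvPu≈l)) ⟩
        x * x * (l * v i)
          ≈⟨ solve 3 (λ x l v → x :* x :* (l :* v) := l :* (x :* x) :* v) refl x l (v i) ⟩
        l * (x * x) * v i
          ≈⟨ ∇∇ v i ⟨
        ∇ P (∇ P v) i
          ≈⟨ eval-cong (∂ i P) Pu≈∇ ⟨
        ∇ P (λ i → x * u i) i
          ≈⟨ ∇-cubic i x u ⟩
        x ^ 3 * ∇ P u i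
          ≈⟨ solve 2 (λ x y → (x :* (x :* (x :* con 1))) :* y := x :* x :* (x :* y)) refl x (∇ P u i) ⟩
        x * x * (x * ∇ P u i) ∎))
      where
      x = eval P v
      PvPu≈l = value-at-gradLog vu

    -- The inverse of `l` is forced: `P(v) * P(u)` is `l` at a logarithmic gradient `u` of `v`,
    -- while the transform requires the product to be one.
    c : Carrier
    c = proj₁ (#0⇒inverse l#0)

    lc≈1 : l * c ≈ 1#
    lc≈1 = proj₂ (#0⇒inverse l#0)

    value-inverse : ∀ {v u} → IsGradLog v u → c * eval P u * eval P v ≈ 1#
    value-inverse {v} {u} vu = begin
      c * eval P u * eval P v   ≈⟨ solve 3 (λ c x y → c :* x :* y := y :* x :* c) refl c _ _ ⟩
      eval P v * eval P u * c   ≈⟨ *-congʳ (value-at-gradLog vu) ⟩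
      l * c                     ≈⟨ lc≈1 ⟩
      1# ∎

    legendre : IsMultiplicativeLegendreTransform (polynomial P) (polynomial (Polynomial.con c ⊠ P))
    legendre =
      (let v , Pv#0 = P≢0 ; u , vu = isGradLog-at Pv#0 in
        v , u , c * eval P u , gradLog⁺ vu , (1#0 , *-identityʳ _)) ,
      λ v u b d vu (_ , b≈cPu) (_ , d≈Pv) → begin
        b * d
          ≈⟨ *-cong (trans (sym (*-identityʳ b)) b≈cPu) (trans (sym (*-identityʳ d)) d≈Pv) ⟩
        c * eval P u * eval P v
          ≈⟨ value-inverse (gradLog⁻ vu) ⟩
        1# ∎

    -- By gradLog-sym every v with P(v) # 0 is itself grad log P(u) for some u, so the values of f*
    -- are prescribed on a dense set.
    legendre-unique : ∀ f* → IsMultiplicativeLegendreTransform (polynomial P) f* →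
                      f* ≐ polynomial (Polynomial.con c ⊠ P)
    legendre-unique f* (_ , f*-legendre) v = trans (*-identityʳ _) (x∙y⁻¹≈ε⇒x≈y _ _ (difference≈0 v))
      where
      difference = num f* ⊞ ⊟ ((Polynomial.con c ⊠ P) ⊠ den f*)

      num≈ : ∀ v → eval P v # 0# → eval (den f*) v # 0# →
             eval (num f*) v ≈ c * eval P v * eval (den f*) v
      num≈ v Pv#0 dv#0 with u , vu ← isGradLog-at Pv#0 | y , dy≈1 ← #0⇒inverse dv#0 = begin
        eval (num f*) v                ≈⟨ f*v≈ ⟨
        b * eval (den f*) v            ≈⟨ *-congʳ (*-cancelˡ-#0 (proj₁ uv) (begin
          eval P u * b                    ≈⟨ *-comm _ _ ⟩
          b * eval P u
            ≈⟨ f*-legendre u v b (eval P u) (gradLog⁺ uv) (dv#0 , f*v≈) (1#0 , *-identityʳ _) ⟩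
          1#                              ≈⟨ value-inverse uv ⟨
          c * eval P v * eval P u         ≈⟨ *-comm _ _ ⟩
          eval P u * (c * eval P v)       ∎)) ⟩
        c * eval P v * eval (den f*) v ∎
        where
        -- The hypothesis on `f*` speaks of its values at logarithmic gradients, so `v` has to be
        -- exhibited as the logarithmic gradient of `u`.
        uv = gradLog-sym vu
        b = y * eval (num f*) v

        f*v≈ : b * eval (den f*) v ≈ eval (num f*) v
        f*v≈ = begin
          y * eval (num f*) v * eval (den f*) v
            ≈⟨ solve 3 (λ y n d → y :* n :* d := d :* y :* n) refl y _ _ ⟩
          eval (den f*) v * y * eval (num f*) v ≈⟨ *-congʳ dy≈1 ⟩
          1# * eval (num f*) v ≈⟨ *-identityˡ _ ⟩
          eval (num f*) v ∎

      -- The equality is known only where both `P` and the denominator are apart from zero.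
      -- Multiplying by `P` absorbs the first condition while the second is removed; a second use of
      -- the principle then removes `P`.
      P*difference≈0 : ∀ v → eval P v * eval difference v ≈ 0#
      P*difference≈0 = identity-principle (den f*) (P ⊠ difference) (den-nonzero f*) (λ v dv#0 →
        *-zero-tight (λ Pd#0 → trans (+-congʳ (num≈ v (factorˡ#0 Pd#0) dv#0)) (-‿inverseʳ _)))

      difference≈0 : ∀ v → eval difference v ≈ 0#
      difference≈0 = identity-principle P difference P≢0 (λ v Pv#0 → *-zero-#0 Pv#0 (P*difference≈0 v))

    self-dual : SelfDual P
    self-dual = (homaloidal , polynomial (Polynomial.con c ⊠ P) , legendre , Polynomial.con c ⊠ P , λ v → refl) ,
      c , inverse⇒#0 (trans (*-comm c l) lc≈1) , legendre-unique

-- Clifford families in an algebra and their sandwich identities.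

record IsCliffordFamily (R : Ring 0ℓ 0ℓ) {n} (E : Fin n → Ring.Carrier R) : Set where
  open Ring R
  field
    square      : ∀ i → E i * E i ≈ 1#
    anticommute : ∀ i j → i ≢ j → E i * E j ≈ - (E j * E i)

module CliffordFamilies (K : CommutativeRing 0ℓ 0ℓ) (A : Algebras.Algebra K) where
  private
    module K where
      open CommutativeRing K public
      open SemiringSum semiring public using (sum)
  open Algebras.Algebra A hiding (zero)
  open RingProperties ring
  open SemiringSum semiring using (sum)
  open RingMorphisms.IsRingHomomorphism scalar-homo
    using (+-homo; *-homo; 0#-homo; -‿homo)
  open MonoidSolver +-commutativeMonoid using (solve; _⊕_; _⊜_)
  open SetoidReasoning setoid

  open IsCliffordFamily

  tail : ∀ {n} {E : Fin (suc n) → Carrier} → IsCliffordFamily ring E → IsCliffordFamily ring (E ∘ suc)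
  tail E-clifford = record
    { square = square E-clifford ∘ suc
    ; anticommute = λ i j i≢j → anticommute E-clifford (suc i) (suc j) (i≢j ∘ Fin.suc-injective) }

  combination : ∀ {n} → (Fin n → K.Carrier) → (Fin n → Carrier) → Carrier
  combination x E = sum (λ i → scalar (x i) * E i)

  scalar-swap : ∀ k a b → a * (scalar k * b) ≈ scalar k * (a * b)
  scalar-swap k a b = begin
    a * (scalar k * b) ≈⟨ *-assoc a (scalar k) b ⟨
    a * scalar k * b   ≈⟨ *-congʳ (scalar-comm k a) ⟨
    scalar k * a * b   ≈⟨ *-assoc (scalar k) a b ⟩
    scalar k * (a * b) ∎

  infix 8 _∘ᴶ_
  -- The anticommutator, twice the Jordan product. On Clifford generators its values are scalars.
  _∘ᴶ_ : Carrier → Carrier → Carrier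
  a ∘ᴶ b = a * b + b * a

  ∘ᴶ-distribʳ : ∀ a b c → (b + c) ∘ᴶ a ≈ b ∘ᴶ a + c ∘ᴶ a
  ∘ᴶ-distribʳ a b c = trans (+-cong (distribʳ a b c) (distribˡ a b c))
    (solve 4 (λ w x y z → (w ⊕ x) ⊕ (y ⊕ z) ⊜ (w ⊕ y) ⊕ (x ⊕ z)) refl _ _ _ _)

  ∘ᴶ-scalar : ∀ k a b → (scalar k * b) ∘ᴶ a ≈ scalar k * (b ∘ᴶ a)
  ∘ᴶ-scalar k a b = trans (+-cong (*-assoc _ _ _) (scalar-swap k a b)) (sym (distribˡ _ _ _))

  combination-∘ᴶ≈0 : ∀ {n} x (E : Fin n → Carrier) a → (∀ i → E i ∘ᴶ a ≈ 0#) → combination x E ∘ᴶ a ≈ 0#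
  combination-∘ᴶ≈0 {zero}  x E a p = trans (+-cong (zeroˡ a) (zeroʳ a)) (+-identityˡ 0#)
  combination-∘ᴶ≈0 {suc n} x E a p = begin
    combination x E ∘ᴶ a ≈⟨ ∘ᴶ-distribʳ a _ _ ⟩
    (scalar (x zero) * E zero) ∘ᴶ a + combination (x ∘ suc) (E ∘ suc) ∘ᴶ a
      ≈⟨ +-cong (trans (∘ᴶ-scalar _ a _) (trans (*-congˡ (p zero)) (zeroʳ _)))
                (combination-∘ᴶ≈0 (x ∘ suc) (E ∘ suc) a (p ∘ suc)) ⟩
    0# + 0# ≈⟨ +-identityˡ 0# ⟩
    0# ∎

  combination-comm : ∀ {n} x (E : Fin n → Carrier) a → (∀ i → E i * a ≈ a * E i) →
                     combination x E * a ≈ a * combination x E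
  combination-comm {zero}  x E a p = trans (zeroˡ a) (sym (zeroʳ a))
  combination-comm {suc n} x E a p = begin
    combination x E * a ≈⟨ distribʳ a _ _ ⟩
    scalar (x zero) * E zero * a + combination (x ∘ suc) (E ∘ suc) * a
      ≈⟨ +-cong (trans (*-assoc _ _ _) (trans (*-congˡ (p zero)) (sym (scalar-swap _ a _))))
                (combination-comm (x ∘ suc) (E ∘ suc) a (p ∘ suc)) ⟩
    a * (scalar (x zero) * E zero) + a * combination (x ∘ suc) (E ∘ suc)
      ≈⟨ distribˡ a _ _ ⟨
    a * combination x E ∎

  module _ {n} {E : Fin n → Carrier} (E-clifford : IsCliffordFamily ring E) where

    ∘ᴶ≈0 : ∀ i j → i ≢ j → E i ∘ᴶ E j ≈ 0#
    ∘ᴶ≈0 i j i≢j = trans (+-congʳ (anticommute E-clifford i j i≢j)) (-‿inverseˡ _)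

  scalar*1 : ∀ k {a} → a ≈ 1# → scalar k * a ≈ scalar k
  scalar*1 k a≈1 = trans (*-congˡ a≈1) (*-identityʳ _)

  -- Every generator other than `E i` anticommutes with `E i`, so a single term survives, and it
  -- contributes twice.
  combination-∘ᴶ : ∀ {n} {E : Fin n → Carrier} → IsCliffordFamily ring E →
                   ∀ x i → combination x E ∘ᴶ E i ≈ scalar (x i K.+ x i)
  combination-∘ᴶ {suc n} {E} cl x zero = begin
    combination x E ∘ᴶ E zero ≈⟨ ∘ᴶ-distribʳ _ _ _ ⟩
    (scalar (x zero) * E zero) ∘ᴶ E zero + combination (x ∘ suc) (E ∘ suc) ∘ᴶ E zero
      ≈⟨ +-cong (∘ᴶ-scalar _ _ _) (combination-∘ᴶ≈0 (x ∘ suc) (E ∘ suc) (E zero) (λ i → ∘ᴶ≈0 cl (suc i) zero (λ ()))) ⟩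
    scalar (x zero) * (E zero * E zero + E zero * E zero) + 0#
      ≈⟨ trans (+-identityʳ _) (distribˡ _ _ _) ⟩
    scalar (x zero) * (E zero * E zero) + scalar (x zero) * (E zero * E zero)
      ≈⟨ +-cong (scalar*1 _ (square cl zero)) (scalar*1 _ (square cl zero)) ⟩
    scalar (x zero) + scalar (x zero) ≈⟨ +-homo _ _ ⟨
    scalar (x zero K.+ x zero) ∎
  combination-∘ᴶ {suc n} {E} cl x (suc i) = begin
    combination x E ∘ᴶ E (suc i) ≈⟨ ∘ᴶ-distribʳ _ _ _ ⟩
    (scalar (x zero) * E zero) ∘ᴶ E (suc i) + combination (x ∘ suc) (E ∘ suc) ∘ᴶ E (suc i)
      ≈⟨ +-cong (trans (∘ᴶ-scalar _ _ _) (trans (*-congˡ (∘ᴶ≈0 cl zero (suc i) (λ ()))) (zeroʳ _)))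
                (combination-∘ᴶ (tail cl) (x ∘ suc) i) ⟩
    0# + scalar (x (suc i) K.+ x (suc i)) ≈⟨ +-identityˡ _ ⟩
    scalar (x (suc i) K.+ x (suc i)) ∎

  combination-square : ∀ {n} {E : Fin n → Carrier} → IsCliffordFamily ring E →
                       ∀ x → combination x E * combination x E ≈ scalar (K.sum (λ i → x i K.* x i))
  combination-square {zero}      cl x = trans (zeroˡ _) (sym 0#-homo)
  combination-square {suc n} {E} cl x = begin
    (a + b) * (a + b)
      ≈⟨ trans (distribʳ _ _ _) (+-cong (distribˡ _ _ _) (distribˡ _ _ _)) ⟩
    (a * a + a * b) + (b * a + b * b)
      ≈⟨ solve 4 (λ w x y z → (w ⊕ x) ⊕ (y ⊕ z) ⊜ (y ⊕ x) ⊕ (w ⊕ z)) refl _ _ _ _ ⟩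
    b ∘ᴶ a + (a * a + b * b)
      ≈⟨ +-cong (combination-∘ᴶ≈0 (x ∘ suc) (E ∘ suc) a anti)
           (+-cong a*a (combination-square (tail cl) (x ∘ suc))) ⟩
    0# + (scalar (x zero K.* x zero) + scalar (K.sum (λ i → x (suc i) K.* x (suc i))))
      ≈⟨ trans (+-identityˡ _) (sym (+-homo _ _)) ⟩
    scalar (K.sum (λ i → x i K.* x i)) ∎
    where
    a = scalar (x zero) * E zero
    b = combination (x ∘ suc) (E ∘ suc)

    anti : ∀ i → E (suc i) ∘ᴶ a ≈ 0#
    anti i = begin
      E (suc i) ∘ᴶ a ≈⟨ +-comm _ _ ⟩
      a ∘ᴶ E (suc i) ≈⟨ ∘ᴶ-scalar _ _ _ ⟩
      scalar (x zero) * (E zero ∘ᴶ E (suc i)) ≈⟨ trans (*-congˡ (∘ᴶ≈0 cl zero (suc i) (λ ()))) (zeroʳ _) ⟩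
      0# ∎

    a*a : a * a ≈ scalar (x zero K.* x zero)
    a*a = begin
      scalar (x zero) * E zero * (scalar (x zero) * E zero) ≈⟨ scalar-swap _ _ _ ⟩
      scalar (x zero) * (scalar (x zero) * E zero * E zero)
        ≈⟨ *-congˡ (trans (*-assoc _ _ _) (scalar*1 _ (square cl zero))) ⟩
      scalar (x zero) * scalar (x zero) ≈⟨ *-homo _ _ ⟨
      scalar (x zero K.* x zero) ∎

  module CommutingFamilies {p q} {E : Fin p → Carrier} {F : Fin q → Carrier}
    (E-clifford : IsCliffordFamily ring E) (F-clifford : IsCliffordFamily ring F)
    (EF-comm : ∀ i j → E i * F j ≈ F j * E i)
    (x : Fin p → K.Carrier) (y : Fin q → K.Carrier) where

    B = combination x E
    D = combination y F
    N = B - D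
    N⁺ = B + D

    norm : K.Carrier
    norm = K.sum (λ i → x i K.* x i) K.- K.sum (λ j → y j K.* y j)

    BD-comm : B * D ≈ D * B
    BD-comm = combination-comm x E D (λ i → sym (combination-comm y F (E i) (λ j → sym (EF-comm i j))))

    scalar-norm : B * B - D * D ≈ scalar norm
    scalar-norm = begin
      B * B - D * D ≈⟨ +-cong (combination-square E-clifford x) (-‿cong (combination-square F-clifford y)) ⟩
      scalar _ - scalar _ ≈⟨ +-congˡ (-‿homo _) ⟨
      scalar _ + scalar _ ≈⟨ +-homo _ _ ⟨
      scalar norm ∎

    N*N⁺ : N * N⁺ ≈ scalar norm
    N*N⁺ = begin
      (B - D) * (B + D)
        ≈⟨ trans (distribʳ _ _ _) (+-cong (distribˡ _ _ _)
             (trans (sym (-‿distribˡ-* _ _)) (-‿cong (distribˡ _ _ _)))) ⟩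
      (B * B + B * D) - (D * B + D * D) ≈⟨ +-congˡ (-‿+-comm _ _) ⟨
      (B * B + B * D) + (- (D * B) - D * D)
        ≈⟨ solve 4 (λ w x y z → (w ⊕ x) ⊕ (y ⊕ z) ⊜ (w ⊕ z) ⊕ (x ⊕ y)) refl _ _ _ _ ⟩
      (B * B - D * D) + (B * D - D * B) ≈⟨ +-cong scalar-norm (trans (+-congʳ BD-comm) (-‿inverseʳ _)) ⟩
      scalar norm + 0# ≈⟨ +-identityʳ _ ⟩
      scalar norm ∎

    N⁺*N : N⁺ * N ≈ scalar norm
    N⁺*N = begin
      (B + D) * (B - D)
        ≈⟨ trans (distribˡ _ _ _) (+-cong (distribʳ _ _ _)
             (trans (sym (-‿distribʳ-* _ _)) (-‿cong (distribʳ _ _ _)))) ⟩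
      (B * B + D * B) - (B * D + D * D) ≈⟨ +-congˡ (-‿+-comm _ _) ⟨
      (B * B + D * B) + (- (B * D) - D * D)
        ≈⟨ solve 4 (λ w x y z → (w ⊕ x) ⊕ (y ⊕ z) ⊜ (w ⊕ z) ⊕ (x ⊕ y)) refl _ _ _ _ ⟩
      (B * B - D * D) + (D * B - B * D) ≈⟨ +-cong scalar-norm (trans (+-congʳ (sym BD-comm)) (-‿inverseʳ _)) ⟩
      scalar norm + 0# ≈⟨ +-identityʳ _ ⟩
      scalar norm ∎

    -- NEN and NFN are the sandwich formulas for N S N with the subtracted term moved across.
    NEN : ∀ i → N * (E i * N) + scalar norm * E i ≈ scalar (x i K.+ x i) * N
    NEN i = begin
      N * (e * N) + scalar norm * e ≈⟨ +-congˡ (trans (*-congʳ (sym N*N⁺)) (*-assoc _ _ _)) ⟩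
      N * (e * N) + N * (N⁺ * e)    ≈⟨ distribˡ _ _ _ ⟨
      N * (e * N + N⁺ * e)          ≈⟨ *-congˡ sandwich ⟩
      N * scalar (x i K.+ x i)      ≈⟨ scalar-comm _ _ ⟨
      scalar (x i K.+ x i) * N ∎
      where
      e = E i
      -- Moving `e` past `N` produces `N⁺` with a minus sign, up to a scalar: `e` commutes with `D`,
      -- and its anticommutator with `B` is a scalar.
      sandwich : e * N + N⁺ * e ≈ scalar (x i K.+ x i)
      sandwich = begin
        e * (B - D) + (B + D) * e
          ≈⟨ +-cong (trans (distribˡ _ _ _) (+-congˡ (sym (-‿distribʳ-* _ _)))) (distribʳ _ _ _) ⟩
        (e * B - e * D) + (B * e + D * e)
          ≈⟨ solve 4 (λ w x y z → (w ⊕ x) ⊕ (y ⊕ z) ⊜ (y ⊕ w) ⊕ (z ⊕ x)) refl _ _ _ _ ⟩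
        B ∘ᴶ e + (D * e - e * D)
          ≈⟨ +-cong (combination-∘ᴶ E-clifford x i)
               (trans (+-congʳ (combination-comm y F e (λ j → sym (EF-comm i j)))) (-‿inverseʳ _)) ⟩
        scalar (x i K.+ x i) + 0# ≈⟨ +-identityʳ _ ⟩
        scalar (x i K.+ x i) ∎

    NFN : ∀ j → N * (F j * N) + scalar (y j K.+ y j) * N ≈ scalar norm * F j
    NFN j = begin
      N * (f * N) + scalar (y j K.+ y j) * N ≈⟨ +-congˡ (scalar-comm _ _) ⟩
      N * (f * N) + N * scalar (y j K.+ y j) ≈⟨ distribˡ _ _ _ ⟨
      N * (f * N + scalar (y j K.+ y j))     ≈⟨ *-congˡ sandwich ⟩
      N * (N⁺ * f)                           ≈⟨ *-assoc _ _ _ ⟨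
      N * N⁺ * f                             ≈⟨ *-congʳ N*N⁺ ⟩
      scalar norm * f ∎
      where
      f = F j
      -- Here `f` commutes with `B` and has a scalar anticommutator with `D`, so `N⁺` appears with a
      -- plus sign. This is the source of the sign difference between the two families.
      sandwich : f * N + scalar (y j K.+ y j) ≈ N⁺ * f
      sandwich = begin
        f * (B - D) + scalar (y j K.+ y j)
          ≈⟨ +-cong (trans (distribˡ _ _ _) (+-congˡ (sym (-‿distribʳ-* _ _)))) (sym (combination-∘ᴶ F-clifford y j)) ⟩
        (f * B - f * D) + (D * f + f * D)
          ≈⟨ solve 4 (λ w x y z → (w ⊕ x) ⊕ (y ⊕ z) ⊜ (w ⊕ y) ⊕ (z ⊕ x)) refl _ _ _ _ ⟩
        (f * B + D * f) + (f * D - f * D)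
          ≈⟨ +-cong (+-congʳ (sym (combination-comm x E f (λ i → EF-comm i j)))) (-‿inverseʳ _) ⟩
        (B * f + D * f) + 0# ≈⟨ +-identityʳ _ ⟩
        B * f + D * f ≈⟨ distribʳ _ _ _ ⟨
        (B + D) * f ∎

-- Quadratic forms, linear functionals on matrices, and formal derivatives.

module QuadraticForms (K : CommutativeRing 0ℓ 0ℓ) (m : ℕ) where
  open CommutativeRing K hiding (zero)
  open Matrices K
  open Polynomials K
  open CliffordFamilies K (matrixAlgebra m) using (combination)
  open RingProperties ring using (-‿distribˡ-*; -0#≈0#; -‿+-comm)
  open SemiringSum semiring
    using (sum; sum-cong-≋; ∑-distrib-+; ∑-comm; *-distribˡ-sum; *-distribʳ-sum; sum-replicate-zero)
  open NaturalSolver commutativeSemiring using (solve; _:=_; _:*_)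
  open SetoidReasoning setoid

  infixr 8 _∙_

  _∙_ : Matrix m → Vector Carrier m → Vector Carrier m
  (M ∙ v) i = sum (λ j → M i j * v j)

  ⟨_,_⟩ : (u v : Vector Carrier m) → Carrier
  ⟨ u , v ⟩ = sum (λ i → u i * v i)

  quadratic : Matrix m → Vector Carrier m → Carrier
  quadratic M v = ⟨ v , M ∙ v ⟩

  sum-neg : ∀ {n} (f : Vector Carrier n) → sum (λ i → - f i) ≈ - sum f
  sum-neg {zero}  f = sym -0#≈0#
  sum-neg {suc n} f = trans (+-congˡ (sum-neg (f ∘ suc))) (-‿+-comm _ _)

  sum-zero : ∀ {n} (f : Vector Carrier n) → (∀ i → f i ≈ 0#) → sum f ≈ 0#
  sum-zero {n} f f≈0 = trans (sum-cong-≋ {n} f≈0) (sum-replicate-zero n)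

  -- A vector is read as the matrix all of whose columns equal it, so the law for vectors is an
  -- entry of a ring law for matrices. The same device gives `∙-*`.
  sum-scalarᴹ : ∀ i (f : Vector Carrier m) → sum (λ j → scalarᴹ 1# i j * f j) ≈ f i
  sum-scalarᴹ i f = proj₁ (Ring.*-identity (matrixRing m)) (λ j _ → f j) i i

  ∙-congˡ : ∀ M {u v} → (∀ i → u i ≈ v i) → ∀ i → (M ∙ u) i ≈ (M ∙ v) i
  ∙-congˡ M u≈v i = sum-cong-≋ {m} (λ j → *-congˡ (u≈v j))

  ∙-* : ∀ M N v i → ((M *ᴹ N) ∙ v) i ≈ (M ∙ N ∙ v) i
  ∙-* M N v i = Ring.*-assoc (matrixRing m) M N (λ j _ → v j) i i

  ∙-scalar : ∀ k v i → (scalarᴹ k ∙ v) i ≈ k * v i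
  ∙-scalar k v i = begin
    (scalarᴹ k ∙ v) i                            ≈⟨ sum-cong-≋ {m} (λ j → trans (*-congʳ (scale j)) (*-assoc k _ _)) ⟩
    sum (λ j → k * (scalarᴹ 1# i j * v j))       ≈⟨ *-distribˡ-sum {m} k _ ⟨
    k * (scalarᴹ 1# ∙ v) i                       ≈⟨ *-congˡ (sum-scalarᴹ i v) ⟩
    k * v i ∎
    where
    scale : ∀ j → scalarᴹ k i j ≈ k * scalarᴹ 1# i j
    scale j with does (i Fin.≟ j)
    ... | true  = sym (*-identityʳ k)
    ... | false = sym (zeroʳ k)

  ∙-homogeneous : ∀ M t v i → (M ∙ (λ j → t * v j)) i ≈ t * (M ∙ v) i
  ∙-homogeneous M t v i = trans
    (sum-cong-≋ {m} (λ j → solve 3 (λ a t v → a :* (t :* v) := t :* (a :* v)) refl (M i j) t (v j)))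
    (sym (*-distribˡ-sum {m} t _))

  quadratic-homogeneous : ∀ M t v → quadratic M (λ j → t * v j) ≈ t * t * quadratic M v
  quadratic-homogeneous M t v = trans
    (sum-cong-≋ {m} (λ i → trans (*-congˡ (∙-homogeneous M t v i))
      (solve 3 (λ t v a → t :* v :* (t :* a) := t :* t :* (v :* a)) refl t (v i) _)))
    (sym (*-distribˡ-sum {m} (t * t) _))

  quadratic-congˡ : ∀ M {u v} → (∀ i → u i ≈ v i) → quadratic M u ≈ quadratic M v
  quadratic-congˡ M u≈v = sum-cong-≋ {m} (λ i → *-cong (u≈v i) (∙-congˡ M u≈v i))

  adjoint : ∀ {M} → SymmetricMatrix M → ∀ u v → ⟨ M ∙ u , v ⟩ ≈ ⟨ u , M ∙ v ⟩
  adjoint {M} M-sym u v = begin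
    sum (λ i → sum (λ j → M i j * u j) * v i)
      ≈⟨ sum-cong-≋ {m} (λ i → *-distribʳ-sum {m} (v i) _) ⟩
    sum (λ i → sum (λ j → M i j * u j * v i))
      ≈⟨ ∑-comm {m} {m} _ ⟩
    sum (λ j → sum (λ i → M i j * u j * v i))
      ≈⟨ sum-cong-≋ {m} (λ j → sum-cong-≋ {m} (λ i → trans (*-congʳ (*-congʳ (M-sym i j)))
           (solve 3 (λ a u v → a :* u :* v := u :* (a :* v)) refl _ (u j) (v i)))) ⟩
    sum (λ j → sum (λ i → u j * (M j i * v i)))
      ≈⟨ sum-cong-≋ {m} (λ j → *-distribˡ-sum {m} (u j) _) ⟨
    sum (λ j → u j * sum (λ i → M j i * v i)) ∎

  -- Identities between matrices become identities between numbers by applying such a functional: an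
  -- entry, an entry of `M ∙ v`, or the value of the quadratic form. Scaling uses `scalarᴹ k *ᴹ M`
  -- because `combination` is built from such products.
  record Linear (L : Matrix m → Carrier) : Set where
    field
      cong   : ∀ {M N} → M ≈ᴹ N → L M ≈ L N
      zeroᴸ  : L (λ _ _ → 0#) ≈ 0#
      plus   : ∀ M N → L (M +ᴹ N) ≈ L M + L N
      neg    : ∀ M → L (-ᴹ M) ≈ - L M
      scale  : ∀ k M → L (scalarᴹ k *ᴹ M) ≈ k * L M

    linear-combination : ∀ {n} x (E : Fin n → Matrix m) → L (combination x E) ≈ sum (λ i → x i * L (E i))
    linear-combination {zero}  x E = zeroᴸ
    linear-combination {suc n} x E = trans (plus _ _) (+-cong (scale _ _) (linear-combination (x ∘ suc) (E ∘ suc)))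

  entry-linear : ∀ i j → Linear (λ M → M i j)
  entry-linear i j = record
    { cong = λ M≈N → M≈N i j ; zeroᴸ = refl ; plus = λ M N → refl ; neg = λ M → refl
    ; scale = λ k M → ∙-scalar k (λ l → M l j) i }

  weighted-sum-linear : ∀ {n} (c : Vector Carrier n) (L : Fin n → Matrix m → Carrier) → (∀ i → Linear (L i)) →
                        Linear (λ M → sum (λ i → L i M * c i))
  weighted-sum-linear {n} c L L-linear = record
    { cong  = λ M≈N → sum-cong-≋ {n} (λ i → *-congʳ (cong (L-linear i) M≈N))
    ; zeroᴸ = sum-zero _ (λ i → trans (*-congʳ (zeroᴸ (L-linear i))) (zeroˡ _))
    ; plus  = λ M N → trans (sum-cong-≋ {n} (λ i → trans (*-congʳ (plus (L-linear i) M N)) (distribʳ _ _ _)))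
                            (∑-distrib-+ {n} _ _)
    ; neg   = λ M → trans (sum-cong-≋ {n} (λ i → trans (*-congʳ (neg (L-linear i) M)) (sym (-‿distribˡ-* _ _))))
                          (sum-neg {n} _)
    ; scale = λ k M → trans (sum-cong-≋ {n} (λ i → trans (*-congʳ (scale (L-linear i) k M)) (*-assoc _ _ _)))
                            (sym (*-distribˡ-sum {n} k _))
    }
    where open Linear

  ∙-linear : ∀ v i → Linear (λ M → (M ∙ v) i)
  ∙-linear v i = weighted-sum-linear v _ (entry-linear i)

  linear-≗ : ∀ {L L′} → (∀ M → L M ≈ L′ M) → Linear L′ → Linear L
  linear-≗ p L′-linear = record
    { cong = λ M≈N → trans (p _) (trans (cong M≈N) (sym (p _)))
    ; zeroᴸ = trans (p _) zeroᴸ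
    ; plus = λ M N → trans (p _) (trans (plus M N) (sym (+-cong (p M) (p N))))
    ; neg = λ M → trans (p _) (trans (neg M) (sym (-‿cong (p M))))
    ; scale = λ k M → trans (p _) (trans (scale k M) (sym (*-congˡ (p M)))) }
    where open Linear L′-linear

  quadratic-linear : ∀ v → Linear (λ M → quadratic M v)
  quadratic-linear v = linear-≗ (λ M → sum-cong-≋ {m} (λ i → *-comm (v i) _))
    (weighted-sum-linear v _ (∙-linear v))

  combination-symmetric : ∀ {n} x (E : Fin n → Matrix m) → (∀ i → SymmetricMatrix (E i)) →
                          SymmetricMatrix (combination x E)
  combination-symmetric {n} x E E-sym i j = begin
    combination x E i j         ≈⟨ Linear.linear-combination (entry-linear i j) x E ⟩
    sum (λ k → x k * E k i j)   ≈⟨ sum-cong-≋ {n} (λ k → *-congˡ (E-sym k i j)) ⟩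
    sum (λ k → x k * E k j i)   ≈⟨ Linear.linear-combination (entry-linear j i) x E ⟨
    combination x E j i ∎

  eval-sumᵖ : ∀ {k n} (f : Fin k → Poly n) v → eval (sumᵖ f) v ≡ sum (λ i → eval (f i) v)
  eval-sumᵖ {zero}  f v = ≡.refl
  eval-sumᵖ {suc k} f v = ≡.cong (eval (f zero) v +_) (eval-sumᵖ (f ∘ suc) v)

  eval-∂-sumᵖ : ∀ {k n} i (f : Fin k → Poly n) v → eval (∂ i (sumᵖ f)) v ≡ sum (λ k → eval (∂ i (f k)) v)
  eval-∂-sumᵖ {zero}  i f v = ≡.refl
  eval-∂-sumᵖ {suc k} i f v = ≡.cong (eval (∂ i (f zero)) v +_) (eval-∂-sumᵖ i (f ∘ suc) v)

  eval-[w] : ∀ M v → eval (M [w]) v ≈ quadratic M v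
  eval-[w] M v = begin
    eval (M [w]) v
      ≈⟨ reflexive (eval-sumᵖ {m} _ v) ⟩
    sum (λ a → eval (sumᵖ (λ b → var a ⊠ con (M a b) ⊠ var b)) v)
      ≈⟨ sum-cong-≋ {m} (λ a → trans (reflexive (eval-sumᵖ {m} _ v)) (sum-cong-≋ {m} (λ b → *-assoc _ _ _))) ⟩
    sum (λ a → sum (λ b → v a * (M a b * v b)))
      ≈⟨ sum-cong-≋ {m} (λ a → *-distribˡ-sum {m} (v a) _) ⟨
    quadratic M v ∎

  eval-∂-[w] : ∀ {M} → SymmetricMatrix M → ∀ i v → eval (∂ i (M [w])) v ≈ (M ∙ v) i + (M ∙ v) i
  eval-∂-[w] {M} M-sym i v = begin
    eval (∂ i (M [w])) v
      ≈⟨ reflexive (eval-∂-sumᵖ {m} i _ v) ⟩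
    sum (λ a → eval (∂ i (sumᵖ (λ b → var a ⊠ con (M a b) ⊠ var b))) v)
      ≈⟨ sum-cong-≋ {m} (λ a → trans (reflexive (eval-∂-sumᵖ {m} i _ v)) (row a)) ⟩
    sum (λ a → δ a * (M ∙ v) a + M i a * v a)
      ≈⟨ ∑-distrib-+ {m} _ _ ⟩
    sum (λ a → δ a * (M ∙ v) a) + (M ∙ v) i
      ≈⟨ +-congʳ (sum-scalarᴹ i (M ∙ v)) ⟩
    (M ∙ v) i + (M ∙ v) i ∎
    where
    δ = scalarᴹ {m} 1# i

    -- The left side is the literal result of the product rule; `v a * 0#` comes from
    -- differentiating the constant `M a b`. Symmetry later makes the two surviving halves equal.
    row : ∀ a → sum (λ b → (δ a * M a b + v a * 0#) * v b + v a * M a b * δ b) ≈ δ a * (M ∙ v) a + M i a * v a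
    row a = begin
      sum (λ b → (δ a * M a b + v a * 0#) * v b + v a * M a b * δ b)
        ≈⟨ ∑-distrib-+ {m} _ _ ⟩
      sum (λ b → (δ a * M a b + v a * 0#) * v b) + sum (λ b → v a * M a b * δ b)
        ≈⟨ +-cong (sum-cong-≋ {m} (λ b → trans (*-congʳ (trans (+-congˡ (zeroʳ _)) (+-identityʳ _))) (*-assoc _ _ _)))
                  (sum-cong-≋ {m} (λ b → *-comm _ _)) ⟩
      sum (λ b → δ a * (M a b * v b)) + sum (λ b → δ b * (v a * M a b))
        ≈⟨ +-cong (sym (*-distribˡ-sum {m} (δ a) _)) (sum-scalarᴹ i (λ b → v a * M a b)) ⟩
      δ a * (M ∙ v) a + v a * M a i
        ≈⟨ +-congˡ (trans (*-comm _ _) (*-congʳ (M-sym a i))) ⟩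
      δ a * (M ∙ v) a + M i a * v a ∎

-- The three properties of the Clifford quartic that give self-duality.

module CliffordQuartic
  (K : HeytingField 0ℓ 0ℓ 0ℓ) (char0 : HeytingFields.CharacteristicZero K) where

  open HeytingField K hiding (zero)
  open RationalFunctions K
  open IdentityPrinciple K char0 using (eval-cong)
  open SelfDuality K char0
  open HeytingProperties heytingCommutativeRing
  open CommutativeRing commutativeRing using (ring; semiring; commutativeSemiring)
  open RawSemiringDefinitions (Semiring.rawSemiring semiring) using (_^_) renaming (_×_ to _·_)
  open RingProperties ring
  open SemiringSum semiring using (sum; sum-cong-≋; *-distribˡ-sum)
  open NaturalSolver commutativeSemiring using (solve; con; _:=_; _:+_; _:*_)
  open SetoidReasoning setoid

  module _ {m p q : ℕ} where
    open Matrices commutativeRing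
    open QuadraticForms commutativeRing m
    open CliffordFamilies commutativeRing (matrixAlgebra m)
    open Linear

    cliffordQuartic : (Fin p → Matrix m) → (Fin q → Matrix m) → Poly m
    cliffordQuartic E F = sumᵖ {p} (λ i → E i [w] ⊠ E i [w]) ⊞ ⊟ sumᵖ {q} (λ j → F j [w] ⊠ F j [w])

    module _ (E : Fin p → Matrix m) (F : Fin q → Matrix m)
      (E-clifford : IsCliffordFamily (matrixRing m) E) (F-clifford : IsCliffordFamily (matrixRing m) F)
      (EF-comm : ∀ i j → (E i *ᴹ F j) ≈ᴹ (F j *ᴹ E i))
      (E-sym : ∀ i → SymmetricMatrix (E i)) (F-sym : ∀ j → SymmetricMatrix (F j)) where

      P = cliffordQuartic E F

      x : Vector Carrier m → Fin p → Carrier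
      x v i = quadratic (E i) v

      y : Vector Carrier m → Fin q → Carrier
      y v j = quadratic (F j) v

      module C v = CommutingFamilies E-clifford F-clifford EF-comm (x v) (y v)

      -- Four occurs both as the degree in Euler's identity and as the factor of the gradient: two
      -- from differentiating a square, two from differentiating a quadratic form.
      κ : Carrier
      κ = 4 · 1#

      -- The gradient freed of its factor `κ`. The sum makes homogeneity and the substitution of
      -- `G v` accessible; `G≈N` gives its form as a matrix acting on `v`.
      G : Vector Carrier m → Vector Carrier m
      G v c = sum (λ i → x v i * (E i ∙ v) c) - sum (λ j → y v j * (F j ∙ v) c)

      eval-P : ∀ v → eval P v ≈ C.norm v
      eval-P v = +-cong (squares E) (-‿cong (squares F))
        where
        squares : ∀ {n} (S : Fin n → Matrix m) →
          eval (sumᵖ (λ i → S i [w] ⊠ S i [w])) v ≈ sum (λ i → quadratic (S i) v * quadratic (S i) v)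
        squares {n} S = trans (reflexive (eval-sumᵖ {n} _ v))
          (sum-cong-≋ {n} (λ i → *-cong (eval-[w] (S i) v) (eval-[w] (S i) v)))

      ∇-P : ∀ v c → ∇ P v c ≈ κ * G v c
      ∇-P v c = begin
        ∇ P v c ≈⟨ +-cong (squares E E-sym) (trans (-‿cong (squares F F-sym)) (-‿distribʳ-* κ _)) ⟩
        κ * sum (λ i → x v i * (E i ∙ v) c) + κ * - sum (λ j → y v j * (F j ∙ v) c)
          ≈⟨ distribˡ κ _ _ ⟨
        κ * G v c ∎
        where
        squares : ∀ {n} (S : Fin n → Matrix m) → (∀ i → SymmetricMatrix (S i)) →
          eval (∂ c (sumᵖ (λ i → S i [w] ⊠ S i [w]))) v ≈ κ * sum (λ i → quadratic (S i) v * (S i ∙ v) c)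
        squares {n} S S-sym = begin
          eval (∂ c (sumᵖ (λ i → S i [w] ⊠ S i [w]))) v ≈⟨ reflexive (eval-∂-sumᵖ {n} c _ v) ⟩
          sum (λ i → eval (∂ c (S i [w])) v * eval (S i [w]) v + eval (S i [w]) v * eval (∂ c (S i [w])) v)
            ≈⟨ sum-cong-≋ {n} (λ i → begin
              eval (∂ c (S i [w])) v * eval (S i [w]) v + eval (S i [w]) v * eval (∂ c (S i [w])) v
                ≈⟨ +-cong (*-cong (∂S i) (S≈ i)) (*-cong (S≈ i) (∂S i)) ⟩
              ((S i ∙ v) c + (S i ∙ v) c) * quadratic (S i) v + quadratic (S i) v * ((S i ∙ v) c + (S i ∙ v) c)
                ≈⟨ solve 2 (λ s t → (t :+ t) :* s :+ s :* (t :+ t) :=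
                     (con 1 :+ (con 1 :+ (con 1 :+ (con 1 :+ con 0)))) :* (s :* t)) refl _ _ ⟩
              κ * (quadratic (S i) v * (S i ∙ v) c) ∎) ⟩
          sum (λ i → κ * (quadratic (S i) v * (S i ∙ v) c)) ≈⟨ *-distribˡ-sum {n} κ _ ⟨
          κ * sum (λ i → quadratic (S i) v * (S i ∙ v) c) ∎
          where
          S≈ = λ i → eval-[w] (S i) v
          ∂S = λ i → eval-∂-[w] (S-sym i) c v

      G≈N : ∀ v c → G v c ≈ (C.N v ∙ v) c
      G≈N v c = sym (begin
        (C.N v ∙ v) c
          ≈⟨ plus (∙-linear v c) (C.B v) (-ᴹ C.D v) ⟩
        (C.B v ∙ v) c + ((-ᴹ C.D v) ∙ v) c
          ≈⟨ +-cong (linear-combination (∙-linear v c) (x v) E)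
               (trans (neg (∙-linear v c) (C.D v)) (-‿cong (linear-combination (∙-linear v c) (y v) F))) ⟩
        G v c ∎)

      -- The coefficients of `E i` and `F j` in `N` are the values of those same forms at `v`, so
      -- linearity produces their squares.
      quadratic-N : ∀ v → quadratic (C.N v) v ≈ C.norm v
      quadratic-N v = begin
        quadratic (C.N v) v ≈⟨ plus (quadratic-linear v) (C.B v) (-ᴹ C.D v) ⟩
        quadratic (C.B v) v + quadratic (-ᴹ C.D v) v
          ≈⟨ +-cong (linear-combination (quadratic-linear v) (x v) E)
               (trans (neg (quadratic-linear v) (C.D v)) (-‿cong (linear-combination (quadratic-linear v) (y v) F))) ⟩
        C.norm v ∎

      N-sym : ∀ v → SymmetricMatrix (C.N v)
      N-sym v i j = +-cong (combination-symmetric (x v) E E-sym i j)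
                           (-‿cong (combination-symmetric (y v) F F-sym i j))

      G-cubic : ∀ t v c → G (λ i → t * v i) c ≈ t ^ 3 * G v c
      G-cubic t v c = begin
        G (λ i → t * v i) c ≈⟨ +-cong (scaled E) (trans (-‿cong (scaled F)) (-‿distribʳ-* _ _)) ⟩
        t ^ 3 * sum (λ i → x v i * (E i ∙ v) c) + t ^ 3 * - sum (λ j → y v j * (F j ∙ v) c)
          ≈⟨ distribˡ _ _ _ ⟨
        t ^ 3 * G v c ∎
        where
        scaled : ∀ {n} (S : Fin n → Matrix m) →
          sum (λ i → quadratic (S i) (λ j → t * v j) * (S i ∙ (λ j → t * v j)) c) ≈
          t ^ 3 * sum (λ i → quadratic (S i) v * (S i ∙ v) c)
        scaled {n} S = trans
          (sum-cong-≋ {n} (λ i → trans (*-cong (quadratic-homogeneous (S i) t v) (∙-homogeneous (S i) t v c))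
            (solve 3 (λ t a b → t :* t :* a :* (t :* b) := t :* (t :* (t :* con 1)) :* (a :* b)) refl t _ _)))
          (sym (*-distribˡ-sum {n} (t ^ 3) _))

      ∇-cubic : ∀ i → Homogeneous 3 (∂ i P)
      ∇-cubic i t v = begin
        ∇ P (λ j → t * v j) i   ≈⟨ ∇-P _ i ⟩
        κ * G (λ j → t * v j) i ≈⟨ *-congˡ (G-cubic t v i) ⟩
        κ * (t ^ 3 * G v i)     ≈⟨ solve 3 (λ a b c → a :* (b :* c) := b :* (a :* c)) refl κ (t ^ 3) (G v i) ⟩
        t ^ 3 * (κ * G v i)     ≈⟨ *-congˡ (∇-P v i) ⟨
        t ^ 3 * ∇ P v i ∎

      euler : ∀ v → sum (λ i → v i * ∇ P v i) ≈ κ * eval P v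
      euler v = begin
        sum (λ i → v i * ∇ P v i)
          ≈⟨ sum-cong-≋ {m} (λ i → trans (*-congˡ (trans (∇-P v i) (*-congˡ (G≈N v i))))
               (solve 3 (λ a b c → a :* (b :* c) := b :* (a :* c)) refl (v i) κ _)) ⟩
        sum (λ i → κ * (v i * (C.N v ∙ v) i)) ≈⟨ *-distribˡ-sum {m} κ _ ⟨
        κ * quadratic (C.N v) v               ≈⟨ *-congˡ (trans (quadratic-N v) (sym (eval-P v))) ⟩
        κ * eval P v ∎

      -- Since `N` is symmetric, the copy of it in the left argument moves across the pairing.
      quadratic-G : ∀ M v → quadratic M (G v) ≈ quadratic (C.N v *ᴹ (M *ᴹ C.N v)) v
      quadratic-G M v = begin
        quadratic M (G v)                   ≈⟨ quadratic-congˡ M (G≈N v) ⟩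
        quadratic M (C.N v ∙ v)             ≈⟨ adjoint (N-sym v) v (M ∙ C.N v ∙ v) ⟩
        ⟨ v , C.N v ∙ M ∙ C.N v ∙ v ⟩       ≈⟨ sum-cong-≋ {m} (λ i → *-congˡ (trans
                                                 (∙-congˡ (C.N v) (λ j → sym (∙-* M (C.N v) v j)) i)
                                                 (sym (∙-* (C.N v) (M *ᴹ C.N v) v i)))) ⟩
        quadratic (C.N v *ᴹ (M *ᴹ C.N v)) v ∎

      -- Evaluating `NEN` at `v` turns its right side into `2 * x * P′`, because `N` itself takes
      -- the value `P′` there; one of the two copies cancels.
      x-G : ∀ v i → x (G v) i ≈ C.norm v * x v i
      x-G v i = trans (quadratic-G (E i) v) (+-cancelʳ (P′ * x v i) _ _ (begin
        quadratic (C.N v *ᴹ (E i *ᴹ C.N v)) v + P′ * x v i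
          ≈⟨ trans (plus L _ _) (+-congˡ (scale L _ _)) ⟨
        quadratic (C.N v *ᴹ (E i *ᴹ C.N v) +ᴹ scalarᴹ P′ *ᴹ E i) v
          ≈⟨ cong L (C.NEN v i) ⟩
        quadratic (scalarᴹ (x v i + x v i) *ᴹ C.N v) v
          ≈⟨ trans (scale L _ _) (*-congˡ (quadratic-N v)) ⟩
        (x v i + x v i) * P′
          ≈⟨ solve 2 (λ x p → (x :+ x) :* p := p :* x :+ p :* x) refl (x v i) P′ ⟩
        P′ * x v i + P′ * x v i ∎))
        where
        L = quadratic-linear v
        P′ = C.norm v

      -- In the evaluation of `NFN` at `v` the term `2 * y * P′` stands on the left against a single
      -- `P′ * y`, which leaves the opposite sign to `x-G`.
      y-G : ∀ v j → y (G v) j ≈ - (C.norm v * y v j)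
      y-G v j = trans (quadratic-G (F j) v) (+-inverseˡ-unique _ _ (+-cancelʳ (P′ * y v j) _ _ (begin
        quadratic (C.N v *ᴹ (F j *ᴹ C.N v)) v + P′ * y v j + P′ * y v j
          ≈⟨ solve 3 (λ q y p → q :+ p :* y :+ p :* y := q :+ (y :+ y) :* p) refl _ (y v j) P′ ⟩
        quadratic (C.N v *ᴹ (F j *ᴹ C.N v)) v + (y v j + y v j) * P′
          ≈⟨ trans (plus L _ _) (+-congˡ (trans (scale L _ _) (*-congˡ (quadratic-N v)))) ⟨
        quadratic (C.N v *ᴹ (F j *ᴹ C.N v) +ᴹ scalarᴹ (y v j + y v j) *ᴹ C.N v) v
          ≈⟨ cong L (C.NFN v j) ⟩
        quadratic (scalarᴹ P′ *ᴹ F j) v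
          ≈⟨ scale L _ _ ⟩
        P′ * y v j
          ≈⟨ +-identityˡ _ ⟨
        0# + P′ * y v j ∎)))
        where
        L = quadratic-linear v
        P′ = C.norm v

      G-G : ∀ v c → G (G v) c ≈ C.norm v * C.norm v * v c
      G-G v c = begin
        sum (λ i → x u i * (E i ∙ u) c) - sum (λ j → y u j * (F j ∙ u) c)
          ≈⟨ +-cong (sum-cong-≋ {p} (λ i → trans (*-congʳ (x-G v i)) (*-assoc _ _ _)))
               -- The minus sign in `G` meets the one from `y-G`, so the second sum enters with a
               -- plus and `N⁺` takes the place of `N`.
               (trans (sym (sum-neg {q} _)) (sum-cong-≋ {q} (λ j → begin
                 - (y u j * (F j ∙ u) c)            ≈⟨ -‿distribˡ-* _ _ ⟩
                 - y u j * (F j ∙ u) c              ≈⟨ *-congʳ (trans (-‿cong (y-G v j)) (-‿involutive _)) ⟩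
                 P′ * y v j * (F j ∙ u) c           ≈⟨ *-assoc _ _ _ ⟩
                 P′ * (y v j * (F j ∙ u) c)         ∎))) ⟩
        sum (λ i → P′ * (x v i * (E i ∙ u) c)) + sum (λ j → P′ * (y v j * (F j ∙ u) c))
          ≈⟨ +-cong (*-distribˡ-sum {p} P′ _) (*-distribˡ-sum {q} P′ _) ⟨
        P′ * sum (λ i → x v i * (E i ∙ u) c) + P′ * sum (λ j → y v j * (F j ∙ u) c)
          ≈⟨ distribˡ P′ _ _ ⟨
        P′ * (sum (λ i → x v i * (E i ∙ u) c) + sum (λ j → y v j * (F j ∙ u) c))
          ≈⟨ *-congˡ (trans (plus L (C.B v) (C.D v))
               (+-cong (linear-combination L (x v) E) (linear-combination L (y v) F))) ⟨
        P′ * (C.N⁺ v ∙ u) c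
          ≈⟨ *-congˡ (∙-congˡ (C.N⁺ v) (G≈N v) c) ⟩
        P′ * (C.N⁺ v ∙ C.N v ∙ v) c
          ≈⟨ *-congˡ (trans (sym (∙-* (C.N⁺ v) (C.N v) v c)) (cong (∙-linear v c) (C.N⁺*N v))) ⟩
        P′ * (scalarᴹ P′ ∙ v) c
          ≈⟨ *-congˡ (∙-scalar P′ v c) ⟩
        P′ * (P′ * v c)
          ≈⟨ *-assoc _ _ _ ⟨
        P′ * P′ * v c ∎
        where
        u = G v
        P′ = C.norm v
        L = ∙-linear u c

      -- The outer gradient contributes one factor `κ`, and the factor `κ` of the inner gradient
      -- comes out cubed.
      ∇-∇ : ∀ v i → ∇ P (∇ P v) i ≈ κ ^ 4 * (eval P v * eval P v) * v i
      ∇-∇ v i = begin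
        ∇ P (∇ P v) i                     ≈⟨ eval-cong (∂ i P) (∇-P v) ⟩
        ∇ P (λ j → κ * G v j) i           ≈⟨ ∇-cubic i κ (G v) ⟩
        κ ^ 3 * ∇ P (G v) i               ≈⟨ *-congˡ (trans (∇-P (G v) i) (*-congˡ (G-G v i))) ⟩
        κ ^ 3 * (κ * (C.norm v * C.norm v * v i))
          ≈⟨ solve 4 (λ a k n v → a :* (k :* (n :* v)) := k :* a :* n :* v) refl (κ ^ 3) κ (C.norm v * C.norm v) (v i) ⟩
        κ ^ 4 * (C.norm v * C.norm v) * v i
          ≈⟨ *-congʳ (*-congˡ (*-cong (eval-P v) (eval-P v))) ⟨
        κ ^ 4 * (eval P v * eval P v) * v i ∎

      κ#0 : κ # 0#
      -- `CharacteristicZero` counts from `suc n`, so the index three stands for four.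
      κ#0 = char0 3

      κ⁴#0 : κ ^ 4 # 0#
      κ⁴#0 = x#0y#0→xy#0 κ#0 (x#0y#0→xy#0 κ#0 (x#0y#0→xy#0 κ#0 (x#0y#0→xy#0 κ#0 1#0)))

      quartic-self-dual : Nonzero P → SelfDual P
      quartic-self-dual P≢0 = self-dual P κ (κ ^ 4) κ#0 κ⁴#0 P≢0 euler ∇-cubic ∇-∇

-- Transport of Clifford relations along ring homomorphisms.

module _ (R S : Ring 0ℓ 0ℓ) where
  private
    module R = Ring R
    module S = Ring S
  open RingProperties S using (+-inverseˡ-unique; +-cancelˡ)
  open SetoidReasoning S.setoid

  -- Additivity between groups forces zero and negatives to be preserved, so these two laws are
  -- derived from the others.
  isRingHomomorphism : (h : R.Carrier → S.Carrier) →
    (∀ {a b} → a R.≈ b → h a S.≈ h b) →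
    (∀ a b → h (a R.+ b) S.≈ h a S.+ h b) →
    (∀ a b → h (a R.* b) S.≈ h a S.* h b) →
    h R.1# S.≈ S.1# →
    IsRingHomomorphism R.rawRing S.rawRing h
  isRingHomomorphism h h-cong h-+ h-* h-1 = record
    { isSemiringHomomorphism = record
      { isNearSemiringHomomorphism = record
        { +-isMonoidHomomorphism = record
          { isMagmaHomomorphism = record
            { isRelHomomorphism = record { cong = h-cong }
            ; homo = h-+ }
          ; ε-homo = h-0 }
        ; *-homo = h-* }
      ; 1#-homo = h-1 }
    ; -‿homo = λ a → +-inverseˡ-unique (h (R.- a)) (h a)
        (S.trans (S.sym (h-+ (R.- a) a)) (S.trans (h-cong (R.-‿inverseˡ a)) h-0)) }
    where
    h-0 : h R.0# S.≈ S.0#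
    h-0 = +-cancelˡ (h R.0#) _ _ (begin
      h R.0# S.+ h R.0# ≈⟨ h-+ R.0# R.0# ⟨
      h (R.0# R.+ R.0#) ≈⟨ h-cong (R.+-identityˡ R.0#) ⟩
      h R.0#            ≈⟨ S.+-identityʳ _ ⟨
      h R.0# S.+ S.0# ∎)

  module _ {h : R.Carrier → S.Carrier} (h-homo : IsRingHomomorphism R.rawRing S.rawRing h) where
    open IsRingHomomorphism h-homo
    open IsCliffordFamily

    image-clifford : ∀ {n} {E : Fin n → R.Carrier} → IsCliffordFamily R E → IsCliffordFamily S (h ∘ E)
    image-clifford cl = record
      { square = λ i → S.trans (S.sym (*-homo _ _)) (S.trans (⟦⟧-cong (square cl i)) 1#-homo)
      ; anticommute = λ i j i≢j → S.trans (S.sym (*-homo _ _))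
          (S.trans (⟦⟧-cong (anticommute cl i j i≢j)) (S.trans (-‿homo _) (S.-‿cong (*-homo _ _)))) }

    image-commute : ∀ {a b} → a R.* b R.≈ b R.* a → h a S.* h b S.≈ h b S.* h a
    image-commute ab≈ba = S.trans (S.sym (*-homo _ _)) (S.trans (⟦⟧-cong ab≈ba) (*-homo _ _))

-- The two Clifford families inside the tensor product.

module _ (K : CommutativeRing 0ℓ 0ℓ) where
  open Algebras K

  module _ (A B : Algebra) where
    private
      module A = Algebra A
      module B = Algebra B
      module T = TensorProduct A B
    open TensorProduct A B using (gen; relation)

    inclusionˡ : IsRingHomomorphism A.rawRing (Algebra.rawRing (A ⊗ B)) (λ a → gen (a , B.1#))
    inclusionˡ = isRingHomomorphism A.ring (Algebra.ring (A ⊗ B)) (λ a → gen (a , B.1#))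
      (λ a≈b → relation (T.cong a≈b B.refl))
      (λ a b → relation (T.linearˡ a b B.1#))
      (λ a b → T.trans (relation (T.cong A.refl (B.sym (B.*-identityˡ B.1#))))
                      (T.sym (relation (T.multiply a b B.1# B.1#))))
      (relation T.unit)

    inclusionʳ : IsRingHomomorphism B.rawRing (Algebra.rawRing (A ⊗ B)) (λ b → gen (A.1# , b))
    inclusionʳ = isRingHomomorphism B.ring (Algebra.ring (A ⊗ B)) (λ b → gen (A.1# , b))
      (λ a≈b → relation (T.cong A.refl a≈b))
      (λ a b → relation (T.linearʳ A.1# a b))
      (λ a b → T.trans (relation (T.cong (A.sym (A.*-identityˡ A.1#)) B.refl))
                      (T.sym (relation (T.multiply A.1# A.1# a b))))
      (relation T.unit)

    -- Both products collapse to the pure tensor of `a` and `b` by the multiplication relation and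
    -- the unit laws.
    inclusions-commute : ∀ a b → gen (a , B.1#) T.*ᵗ gen (A.1# , b) T.∼ gen (A.1# , b) T.*ᵗ gen (a , B.1#)
    inclusions-commute a b = T.trans (relation (T.multiply a A.1# B.1# b)) (T.trans
      (relation (T.cong (A.trans (A.*-identityʳ a) (A.sym (A.*-identityˡ a)))
                        (B.trans (B.*-identityˡ b) (B.sym (B.*-identityʳ b)))))
      (T.sym (relation (T.multiply A.1# a b B.1#))))

  generators-clifford : ∀ r → IsCliffordFamily (Algebra.ring (C r)) (e {r})
  generators-clifford r = record
    { square      = λ i → CliffordAlgebra.relation (CliffordAlgebra.square i)
    ; anticommute = λ i j i≢j → CliffordAlgebra.relation (CliffordAlgebra.anti i j i≢j) }

  module _ (p q : ℕ) where
    private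
      R = Algebra.ring R[ p , q ]
      module R = Ring R
      module T = TensorProduct (C p) (C q)
    open TensorProduct (C p) (C q) using (gen)

    basis-↑ˡ : ∀ i → basis p q (i ↑ˡ q) ≡ gen (e i , Algebra.1# (C q))
    basis-↑ˡ i = ≡.cong [ _ , _ ]′ (Fin.splitAt-↑ˡ p i q)

    basis-↑ʳ : ∀ j → basis p q (p ↑ʳ j) ≡ gen (Algebra.1# (C p) , e j)
    basis-↑ʳ j = ≡.cong [ _ , _ ]′ (Fin.splitAt-↑ʳ p q j)

    -- The basis is defined by cases on `splitAt`, which is resolved only up to propositional
    -- equality; the relations of the generators are carried across it.
    clifford-≗ : ∀ {n} {E F : Fin n → R.Carrier} → (∀ i → E i ≡ F i) →
                 IsCliffordFamily R F → IsCliffordFamily R E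
    clifford-≗ {E = E} {F} E≡F cl = record
      { square = λ i → ≡.subst (λ x → x R.* x R.≈ R.1#) (≡.sym (E≡F i)) (square i)
      ; anticommute = λ i j i≢j →
          ≡.subst (λ x → x R.* E j R.≈ R.- (E j R.* x)) (≡.sym (E≡F i))
            (≡.subst (λ y → F i R.* y R.≈ R.- (y R.* F i)) (≡.sym (E≡F j)) (anticommute i j i≢j)) }
      where open IsCliffordFamily cl

    basisˡ-clifford : IsCliffordFamily R (λ i → basis p q (i ↑ˡ q))
    basisˡ-clifford = clifford-≗ basis-↑ˡ
      (image-clifford (Algebra.ring (C p)) R (inclusionˡ (C p) (C q)) (generators-clifford p))

    basisʳ-clifford : IsCliffordFamily R (λ j → basis p q (p ↑ʳ j))
    basisʳ-clifford = clifford-≗ basis-↑ʳ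
      (image-clifford (Algebra.ring (C q)) R (inclusionʳ (C p) (C q)) (generators-clifford q))

    basis-commute : ∀ i j →
      basis p q (i ↑ˡ q) R.* basis p q (p ↑ʳ j) R.≈ basis p q (p ↑ʳ j) R.* basis p q (i ↑ˡ q)
    basis-commute i j = ≡.subst₂ (λ x y → x R.* y R.≈ y R.* x) (≡.sym (basis-↑ˡ i)) (≡.sym (basis-↑ʳ j))
      (inclusions-commute (C p) (C q) (e i) (e j))

-- Extension of scalars for matrices.

module _ (K L : CommutativeRing 0ℓ 0ℓ) where
  private
    module K = CommutativeRing K
    module L = CommutativeRing L
    module Kᴹ = Matrices K
    module Lᴹ = Matrices L

  module _ {f : K.Carrier → L.Carrier} (f-homo : IsRingHomomorphism K.rawRing L.rawRing f) where
    open IsRingHomomorphism f-homo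
    open SemiringSum K.semiring using () renaming (sum to sumᴷ)
    open SemiringSum L.semiring using () renaming (sum to sumᴸ; sum-cong-≋ to sumᴸ-cong)

    sum-homo : ∀ {n} (v : Vector K.Carrier n) → f (sumᴷ v) L.≈ sumᴸ (f ∘ v)
    sum-homo {zero}  v = 0#-homo
    sum-homo {suc n} v = L.trans (+-homo _ _) (L.+-congˡ (sum-homo (v ∘ suc)))

    matrix-homo : ∀ m → IsRingHomomorphism (Ring.rawRing (Kᴹ.matrixRing m)) (Ring.rawRing (Lᴹ.matrixRing m))
                          (λ M i j → f (M i j))
    matrix-homo m = isRingHomomorphism (Kᴹ.matrixRing m) (Lᴹ.matrixRing m) _
      (λ M≈N i j → ⟦⟧-cong (M≈N i j))
      (λ M N i j → +-homo _ _)
      (λ M N i j → L.trans (sum-homo {m} _) (sumᴸ-cong {m} (λ k → *-homo _ _)))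
      one
      where
      one : ∀ i j → f (Kᴹ.scalarᴹ K.1# i j) L.≈ Lᴹ.scalarᴹ L.1# i j
      one i j with does (i Fin.≟ j)
      ... | true  = 1#-homo
      ... | false = 0#-homo

-- From the reals to the complex numbers.

module Complexification (𝓡 : RealNumbers) where
  open RealNumbers 𝓡 hiding (zero)
  private module O = IsStrictPartialOrder isStrictPartialOrder
  open CliffordQuarticForms 𝓡 using (ℝ-ring; ℂ-field; fromReal; complexify)
  open Complex 𝓡 using (re)
  open HeytingProperties heytingCommutativeRing using (1#0)
  private
    ℂ-ring = RationalFunctions.commutativeRing ℂ-field
    module ℂ = CommutativeRing ℂ-ring
  open RingProperties (CommutativeRing.ring ℝ-ring)

  0<1 : 0# < 1#
  0<1 with #⇒<⊎> 1#0
  ... | inj₂ 0<1 = 0<1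
  ... | inj₁ 1<0 = O.<-respʳ-≈ [-1]²≈1 (*-pos 0<-1 0<-1)
    where
    0<-1 : 0# < - 1#
    0<-1 = O.<-respˡ-≈ (-‿inverseʳ 1#) (O.<-respʳ-≈ (+-identityˡ _) (+-monoˡ-< (- 1#) 1<0))

    [-1]²≈1 : - 1# * - 1# ≈ 1#
    [-1]²≈1 = trans (-1*x≈-x (- 1#)) (-‿involutive 1#)

  suc·1-pos : ∀ n → 0# < suc n · 1#
  suc·1-pos zero    = O.<-respʳ-≈ (sym (+-identityʳ 1#)) 0<1
  suc·1-pos (suc n) = O.trans (suc·1-pos n) (O.<-respˡ-≈ (+-identityˡ _) (+-monoˡ-< (suc n · 1#) 0<1))

  open HeytingFields ℂ-field using (CharacteristicZero)

  -- The real part of a multiple of one is the same multiple in the ordered field of reals, where it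
  -- is positive.
  ℂ-char0 : CharacteristicZero
  ℂ-char0 n = inj₁ (≡.subst (_# 0#) (≡.sym (re-· (suc n))) (#-sym (<⇒# (suc·1-pos n))))
    where
    open Mult ℂ.+-monoid using () renaming (_×_ to _·ᶜ_)
    re-· : ∀ n → re (n ·ᶜ ℂ.1#) ≡ n · 1#
    re-· zero    = ≡.refl
    re-· (suc n) = ≡.cong (1# +_) (re-· n)

  fromReal-homo : IsRingHomomorphism (CommutativeRing.rawRing ℝ-ring) ℂ.rawRing fromReal
  fromReal-homo = isRingHomomorphism (CommutativeRing.ring ℝ-ring) ℂ.ring fromReal
    (λ a≈b → a≈b , refl)
    (λ a b → refl , sym (+-identityˡ 0#))
    (λ a b → sym (trans (+-congˡ (trans (-‿cong (zeroˡ 0#)) -0#≈0#)) (+-identityʳ _)) ,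
             sym (trans (+-cong (zeroʳ a) (zeroˡ b)) (+-identityˡ 0#)))
    (refl , refl)

  module ℝᵖ = Polynomials ℝ-ring
  module ℂᵖ = Polynomials ℂ-ring

  -- Equality of syntax trees is wanted, not of values: `SelfDual` refers to formal derivatives of
  -- the tree and is transported along the equality.
  complexify-sumᵖ : ∀ {k n} {f : Fin k → ℝᵖ.Poly n} {g : Fin k → ℂᵖ.Poly n} →
                    (∀ i → complexify (f i) ≡ g i) → complexify (ℝᵖ.sumᵖ f) ≡ ℂᵖ.sumᵖ g
  complexify-sumᵖ {zero}  p = ≡.refl
  complexify-sumᵖ {suc k} p = ≡.cong₂ _⊞_ (p zero) (complexify-sumᵖ (p ∘ suc))

  complexify-[w] : ∀ {m} (M : Matrices.Matrix ℝ-ring m) →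
                   complexify (M ℝᵖ.[w]) ≡ (λ i j → fromReal (M i j)) ℂᵖ.[w]
  complexify-[w] {m} M = complexify-sumᵖ {m} (λ a → complexify-sumᵖ {m} (λ b → ≡.refl))

-- Self-duality for the quartic form of a representation.

open import Data.Nat using (_+_; _≤_)

theorem4p4 : (𝓡 : RealNumbers) → let open CliffordQuarticForms 𝓡 in
    (p q m : ℕ) → 1 ≤ p + q →
    (ρ : Representation p q m) → let S = basisMatrix ρ in
    (∀ i → SymmetricMatrix (S i)) →
    NonDegenerate p q S →
    IsHomaloidalEKP (P̃ p q S) ×
    (∃[ c ] (c # 0#) × (∀ f* →
    IsMultiplicativeLegendreTransform (polynomial (P̃ p q S)) f* →
    f* ≐ polynomial (con c ⊠ P̃ p q S)))
theorem4p4 𝓡 p q m _ ρ S-symmetric (_ , P̃≢0) =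
  ≡.subst SelfDual (≡.sym P̃≡) (quartic-self-dual (λ i → T (i ↑ˡ q)) (λ j → T (p ↑ʳ j))
    (clifford (basisˡ-clifford ℝ-ring p q)) (clifford (basisʳ-clifford ℝ-ring p q))
    -- Commutation of the two families starts in the tensor product and passes through `ρ` and then
    -- through the entrywise inclusion of real into complex matrices.
    (λ i j → image-commute 𝕄ℝ 𝕄ℂ fromRealᴹ
      {S (i ↑ˡ q)} {S (p ↑ʳ j)} (image-commute R 𝕄ℝ ρ-homo (basis-commute ℝ-ring p q i j)))
    (λ i → T-symmetric (i ↑ˡ q)) (λ j → T-symmetric (p ↑ʳ j))
    (≡.subst Nonzero P̃≡ P̃≢0))
  where
  open CliffordQuarticForms 𝓡
  open Complexification 𝓡
  open CliffordQuartic ℂ-field ℂ-char0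
  open SelfDuality ℂ-field ℂ-char0 using (SelfDual)
  open AlgebraHom ρ using () renaming (isHomomorphism to ρ-homo)
  ℂ-ring    = RationalFunctions.commutativeRing ℂ-field
  R         = Algebras.Algebra.ring R[ p , q ]
  𝕄ℝ        = Matrices.matrixRing ℝ-ring m
  𝕄ℂ        = Matrices.matrixRing ℂ-ring m
  S         = basisMatrix ρ
  fromRealᴹ = matrix-homo ℝ-ring ℂ-ring fromReal-homo m

  T : Fin (p + q) → Matrices.Matrix ℂ-ring m
  T k i j = fromReal (S k i j)

  clifford : ∀ {n} {E : Fin n → Ring.Carrier R} → IsCliffordFamily R E →
             IsCliffordFamily 𝕄ℂ (λ k i j → fromReal (AlgebraHom.⟦_⟧ ρ (E k) i j))
  clifford cl = image-clifford 𝕄ℝ 𝕄ℂ fromRealᴹ (image-clifford R 𝕄ℝ ρ-homo cl)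

  T-symmetric : ∀ k → Matrices.SymmetricMatrix ℂ-ring (T k)
  T-symmetric k i j = IsRingHomomorphism.⟦⟧-cong fromReal-homo (S-symmetric k i j)

  P̃≡ : P̃ p q S ≡ cliffordQuartic (λ i → T (i ↑ˡ q)) (λ j → T (p ↑ʳ j))
  P̃≡ = ≡.cong₂ (λ a b → a ⊞ ⊟ b) (squares (λ i → S (i ↑ˡ q))) (squares (λ j → S (p ↑ʳ j)))
    where
    squares : ∀ {n} (S : Fin n → Matrix m) →
              complexify (ℝᵖ.sumᵖ (λ i → S i ℝᵖ.[w] ⊠ S i ℝᵖ.[w])) ≡
              ℂᵖ.sumᵖ (λ i → (λ a b → fromReal (S i a b)) ℂᵖ.[w] ⊠ (λ a b → fromReal (S i a b)) ℂᵖ.[w])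
    squares S = complexify-sumᵖ (λ i → ≡.cong₂ _⊠_ (complexify-[w] (S i)) (complexify-[w] (S i)))
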